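{- For any positive integer $m$, \[ \sum_{k=0}^n\binom{mn}{mk}\sim \frac{1}{m}\exp(mn\log 2)=\frac{2^{mn}}{m} \] as $n\to\infty$.
   Context: For $f,g:\mathbb{Z}_{\ge 0}\to\mathbb{C}$, $f\sim g$ means $\lim_{n\to\infty} f(n)/g(n)=1$. Here $m$ is fixed and both sides are regarded as functions of $n\in\mathbb{Z}_{\ge 0}$; $\log$ is the natural logarithm. -}

module Defs where

open import Data.Integer.Base as ℤ using (+_)
import Data.Integer.Properties as ℤ
open import Data.Nat.Base as ℕ using (ℕ; zero; suc)
import Data.Nat.Properties as ℕ
open import Data.Product using (Σ; ∃; ∃-syntax; _×_; _,_; proj₁; proj₂)
open import Data.Rational
open import Data.Rational.Properties
import Data.Rational.Solver as ℚSolver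
import Data.Rational.Unnormalised as ℚᵘ
import Data.Rational.Unnormalised.Properties as ℚᵘ
open import Data.Sum using (_⊎_; inj₁; inj₂)
open import Relation.Binary.PropositionalEquality
  using (_≡_; _≢_; refl; sym; trans; cong; cong₂; subst; subst₂)
open import Relation.Nullary using (yes; no; contradiction)

open ℚSolver.+-*-Solver using (solve; _:+_; _:*_; _:-_; :-_; _:=_; con)

fromℕ : ℕ → ℚ
fromℕ n = + n / 1

fromℕ-suc : ∀ n → fromℕ (suc n) ≡ 1ℚ + fromℕ n
fromℕ-suc n = toℚᵘ-injective (begin
  toℚᵘ (fromℕ (suc n))                 ≈⟨ toℚᵘ-fromℚᵘ (ℚᵘ.mkℚᵘ (+ suc n) 0) ⟩
  ℚᵘ.mkℚᵘ (+ suc n) 0                  ≈⟨ ℚᵘ.*≡* (cong (ℤ._* + 1) (cong (ℤ._+_ (+ 1)) (sym (ℤ.*-identityʳ (+ n))))) ⟩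
  ℚᵘ.1ℚᵘ ℚᵘ.+ ℚᵘ.mkℚᵘ (+ n) 0          ≈⟨ ℚᵘ.+-congʳ ℚᵘ.1ℚᵘ (ℚᵘ.≃-sym (toℚᵘ-fromℚᵘ (ℚᵘ.mkℚᵘ (+ n) 0))) ⟩
  toℚᵘ 1ℚ ℚᵘ.+ toℚᵘ (fromℕ n)          ≈⟨ ℚᵘ.≃-sym (toℚᵘ-homo-+ 1ℚ (fromℕ n)) ⟩
  toℚᵘ (1ℚ + fromℕ n)                  ∎)
  where open ℚᵘ.≃-Reasoning

0≤fromℕ : ∀ n → 0ℚ ≤ fromℕ n
0≤fromℕ n = nonNegative⁻¹ (fromℕ n) {{normalize-nonNeg n 1}}

0<fromℕ : ∀ n → 0ℚ < fromℕ (suc n)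
0<fromℕ n = positive⁻¹ (fromℕ (suc n)) {{normalize-pos (suc n) 1}}

fromℕ-mono : ∀ {m n} → m ℕ.≤ n → fromℕ m ≤ fromℕ n
fromℕ-mono {m} {n} m≤n = toℚᵘ-cancel-≤
  (ℚᵘ.≤-respˡ-≃ (ℚᵘ.≃-sym (toℚᵘ-fromℚᵘ (ℚᵘ.mkℚᵘ (+ m) 0)))
  (ℚᵘ.≤-respʳ-≃ (ℚᵘ.≃-sym (toℚᵘ-fromℚᵘ (ℚᵘ.mkℚᵘ (+ n) 0)))
  (ℚᵘ.*≤* (ℤ.*-monoʳ-≤-nonNeg (+ 1) (ℤ.+≤+ m≤n)))))

archimedean : ∀ q → ∃[ n ] q ≤ fromℕ n
archimedean q@(mkℚ (+ a) d c) = a , toℚᵘ-cancel-≤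
  (ℚᵘ.≤-respʳ-≃ (ℚᵘ.≃-sym (toℚᵘ-fromℚᵘ (ℚᵘ.mkℚᵘ (+ a) 0)))
  (ℚᵘ.*≤* (subst₂ ℤ._≤_ (ℤ.pos-* a 1) (ℤ.pos-* a (suc d))
    (ℤ.+≤+ (ℕ.*-monoʳ-≤ a (ℕ.s≤s ℕ.z≤n))))))
archimedean q@(mkℚ ℤ.-[1+ a ] d c) = 0 , ≤-trans (<⇒≤ (negative⁻¹ q)) (0≤fromℕ 0)

unit : ℕ → ℚ
unit i = + 1 / suc i

0≤unit : ∀ i → 0ℚ ≤ unit i
0≤unit i = nonNegative⁻¹ (unit i) {{normalize-nonNeg 1 (suc i)}}

fromℕ*unit : ∀ i → fromℕ (suc i) * unit i ≡ 1ℚ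
fromℕ*unit i = toℚᵘ-injective (begin
  toℚᵘ (fromℕ (suc i) * unit i)                    ≈⟨ toℚᵘ-homo-* (fromℕ (suc i)) (unit i) ⟩
  toℚᵘ (fromℕ (suc i)) ℚᵘ.* toℚᵘ (unit i)          ≈⟨ ℚᵘ.*-cong (toℚᵘ-fromℚᵘ (ℚᵘ.mkℚᵘ (+ suc i) 0)) (toℚᵘ-fromℚᵘ (ℚᵘ.mkℚᵘ (+ 1) i)) ⟩
  ℚᵘ.mkℚᵘ (+ suc i) 0 ℚᵘ.* ℚᵘ.mkℚᵘ (+ 1) i         ≈⟨ ℚᵘ.*≡* (cong +_ (eq i)) ⟩
  ℚᵘ.1ℚᵘ                                           ∎)
  where
  open ℚᵘ.≃-Reasoning
  eq : ∀ i → suc i ℕ.* 1 ℕ.* 1 ≡ 1 ℕ.* (1 ℕ.* suc i)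
  eq i = trans (ℕ.*-identityʳ _) (trans (ℕ.*-identityʳ _) (sym (trans (ℕ.*-identityˡ _) (ℕ.*-identityˡ _))))

*-monoˡ : ∀ {r p q} → 0ℚ ≤ r → p ≤ q → r * p ≤ r * q
*-monoˡ {r} 0≤r = *-monoˡ-≤-nonNeg r {{nonNegative 0≤r}}

*-monoʳ : ∀ {r p q} → 0ℚ ≤ r → p ≤ q → p * r ≤ q * r
*-monoʳ {r} 0≤r = *-monoʳ-≤-nonNeg r {{nonNegative 0≤r}}

*-mono : ∀ {p q r s} → 0ℚ ≤ q → 0ℚ ≤ r → p ≤ q → r ≤ s → p * r ≤ q * s
*-mono 0≤q 0≤r p≤q r≤s = ≤-trans (*-monoʳ 0≤r p≤q) (*-monoˡ 0≤q r≤s)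

0≤* : ∀ {p q} → 0ℚ ≤ p → 0ℚ ≤ q → 0ℚ ≤ p * q
0≤* {p} {q} 0≤p 0≤q = subst (_≤ p * q) (*-zeroʳ p) (*-monoˡ 0≤p 0≤q)

0<* : ∀ {p q} → 0ℚ < p → 0ℚ < q → 0ℚ < p * q
0<* {p} {q} 0<p 0<q =
  positive⁻¹ (p * q) {{pos*pos⇒pos p {{positive 0<p}} q {{positive 0<q}}}}

0≤+ : ∀ {p q} → 0ℚ ≤ p → 0ℚ ≤ q → 0ℚ ≤ p + q
0≤+ {p} {q} 0≤p 0≤q = subst (_≤ p + q) (+-identityˡ 0ℚ) (+-mono-≤ 0≤p 0≤q)

p≤p+q : ∀ {p q} → 0ℚ ≤ q → p ≤ p + q
p≤p+q {p} {q} 0≤q = subst (_≤ p + q) (+-identityʳ p) (+-monoʳ-≤ p 0≤q)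

∣-∣-comm : ∀ p q → ∣ p - q ∣ ≡ ∣ q - p ∣
∣-∣-comm p q = trans
  (cong ∣_∣ (solve 2 (λ p q → p :- q := :- (q :- p)) refl p q)) (∣-p∣≡∣p∣ (q - p))

∣-∣-triangle : ∀ p q r → ∣ p - r ∣ ≤ ∣ p - q ∣ + ∣ q - r ∣
∣-∣-triangle p q r = subst (_≤ ∣ p - q ∣ + ∣ q - r ∣)
  (cong ∣_∣ (solve 3 (λ p q r → (p :- q) :+ (q :- r) := p :- r) refl p q r))
  (∣p+q∣≤∣p∣+∣q∣ (p - q) (q - r))

p≤∣p∣ : ∀ p → p ≤ ∣ p ∣
p≤∣p∣ p with ≤-total 0ℚ p
... | inj₁ 0≤p = ≤-reflexive (sym (0≤p⇒∣p∣≡p 0≤p))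
... | inj₂ p≤0 = ≤-trans p≤0 (0≤∣p∣ p)

∣-∣-lub : ∀ {p q} → p ≤ q → - p ≤ q → ∣ p ∣ ≤ q
∣-∣-lub {p} {q} p≤q -p≤q with ∣p∣≡p∨∣p∣≡-p p
... | inj₁ eq = subst (_≤ q) (sym eq) p≤q
... | inj₂ eq = subst (_≤ q) (sym eq) -p≤q

∣p∣≤∣q∣+∣p-q∣ : ∀ p q → ∣ p ∣ ≤ ∣ q ∣ + ∣ p - q ∣
∣p∣≤∣q∣+∣p-q∣ p q = subst (_≤ ∣ q ∣ + ∣ p - q ∣)
  (cong ∣_∣ (solve 2 (λ p q → q :+ (p :- q) := p) refl p q)) (∣p+q∣≤∣p∣+∣q∣ q (p - q))

p≤q+r⇒p-q≤r : ∀ {p q r} → p ≤ q + r → p - q ≤ r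
p≤q+r⇒p-q≤r {p} {q} {r} h = subst (p - q ≤_)
  (solve 2 (λ q r → (q :+ r) :- q := r) refl q r) (+-monoˡ-≤ (- q) h)

∣∣p∣-∣q∣∣≤∣p-q∣ : ∀ p q → ∣ ∣ p ∣ - ∣ q ∣ ∣ ≤ ∣ p - q ∣
∣∣p∣-∣q∣∣≤∣p-q∣ p q = ∣-∣-lub (p≤q+r⇒p-q≤r (∣p∣≤∣q∣+∣p-q∣ p q))
  (subst₂ _≤_ (solve 2 (λ a b → b :- a := :- (a :- b)) refl ∣ p ∣ ∣ q ∣) (∣-∣-comm q p)
    (p≤q+r⇒p-q≤r (∣p∣≤∣q∣+∣p-q∣ q p)))

-- Small D: the double sequence D is eventually below every ε > 0.
Small : (ℕ → ℕ → ℚ) → Set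
Small D = ∀ ε → 0ℚ < ε → ∃[ N ] (∀ i j → N ℕ.≤ i → N ℕ.≤ j → D i j < ε)

½*½ : ∀ ε → ½ * ε + ½ * ε ≡ ε
½*½ ε = solve 1 (λ ε → con ½ :* ε :+ con ½ :* ε := ε) refl ε

small-+ : ∀ {D E} → Small D → Small E → Small (λ i j → D i j + E i j)
small-+ {D} {E} sD sE ε 0<ε = M ℕ.⊔ N , λ i j h h′ → subst (D i j + E i j <_) (½*½ ε)
  (+-mono-< (proj₂ (sD (½ * ε) 0<½ε) i j (ℕ.m⊔n≤o⇒m≤o M N h) (ℕ.m⊔n≤o⇒m≤o M N h′))
            (proj₂ (sE (½ * ε) 0<½ε) i j (ℕ.m⊔n≤o⇒n≤o M N h) (ℕ.m⊔n≤o⇒n≤o M N h′)))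
  where
  0<½ε : 0ℚ < ½ * ε
  0<½ε = 0<* (positive⁻¹ ½) 0<ε
  M N : ℕ
  M = proj₁ (sD (½ * ε) 0<½ε)
  N = proj₁ (sE (½ * ε) 0<½ε)

small-* : ∀ {D} c → Small D → (∀ i j → 0ℚ ≤ D i j) → Small (λ i j → c * D i j)
small-* {D} c sD 0≤D ε 0<ε with archimedean c
... | n , c≤n = proj₁ s , λ i j h h′ → ≤-<-trans
      (*-monoʳ (0≤D i j) (≤-trans c≤n (fromℕ-mono (ℕ.n≤1+n n))))
      (subst (fromℕ (suc n) * D i j <_) eq
        (*-monoʳ-<-pos (fromℕ (suc n)) {{positive (0<fromℕ n)}} (proj₂ s i j h h′)))
  where
  s : ∃[ N ] (∀ i j → N ℕ.≤ i → N ℕ.≤ j → D i j < unit n * ε)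
  s = sD (unit n * ε) (0<* (positive⁻¹ (unit n) {{normalize-pos 1 (suc n)}}) 0<ε)
  eq : fromℕ (suc n) * (unit n * ε) ≡ ε
  eq = trans (sym (*-assoc (fromℕ (suc n)) (unit n) ε))
             (trans (cong (_* ε) (fromℕ*unit n)) (*-identityˡ ε))

small-≤ : ∀ {D E} M → (∀ i j → M ℕ.≤ i → M ℕ.≤ j → D i j ≤ E i j) → Small E → Small D
small-≤ M D≤E sE ε 0<ε = M ℕ.⊔ proj₁ s , λ i j h h′ → ≤-<-trans
    (D≤E i j (ℕ.m⊔n≤o⇒m≤o M _ h) (ℕ.m⊔n≤o⇒m≤o M _ h′))
    (proj₂ s i j (ℕ.m⊔n≤o⇒n≤o M _ h) (ℕ.m⊔n≤o⇒n≤o M _ h′))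
  where s = sE ε 0<ε

Cauchy : (ℕ → ℚ) → Set
Cauchy x = ∀ ε → 0ℚ < ε → ∃[ N ] (∀ i j → N ℕ.≤ i → N ℕ.≤ j → ∣ x i - x j ∣ < ε)

record ℝ : Set where
  constructor mkℝ
  field
    seq    : ℕ → ℚ
    cauchy : Cauchy seq

open ℝ public

infix 4 _≃ᴿ_ _<ᴿ_ _#_

_≃ᴿ_ : ℝ → ℝ → Set
x ≃ᴿ y = ∀ ε → 0ℚ < ε → ∃[ N ] (∀ k → N ℕ.≤ k → ∣ seq x k - seq y k ∣ < ε)

_<ᴿ_ : ℝ → ℝ → Set
x <ᴿ y = ∃[ δ ] 0ℚ < δ × ∃[ N ] (∀ k → N ℕ.≤ k → seq x k + δ ≤ seq y k)

-- Apartness, the constructive form of x ≠ y.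
_#_ : ℝ → ℝ → Set
x # y = x <ᴿ y ⊎ y <ᴿ x

fromℚ : ℚ → ℝ
fromℚ q = mkℝ (λ _ → q) λ ε 0<ε → 0 , λ _ _ _ _ →
  subst (_< ε) (sym (cong ∣_∣ (+-inverseʳ q))) 0<ε

0ᴿ 1ᴿ : ℝ
0ᴿ = fromℚ 0ℚ
1ᴿ = fromℚ 1ℚ

bounded : ∀ x → ∃[ b ] ∃[ N ] (∀ k → N ℕ.≤ k → ∣ seq x k ∣ ≤ fromℕ b)
bounded x with cauchy x 1ℚ (positive⁻¹ 1ℚ)
... | N , close with archimedean (∣ seq x N ∣ + 1ℚ)
... | b , le = b , N , λ k h → ≤-trans (∣p∣≤∣q∣+∣p-q∣ (seq x k) (seq x N))
      (≤-trans (+-monoʳ-≤ ∣ seq x N ∣ (<⇒≤ (close k N h ℕ.≤-refl))) le)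

infixl 6 _-ᴿ_
infixl 7 _*ᴿ_

_-ᴿ_ : ℝ → ℝ → ℝ
x -ᴿ y = mkℝ (λ k → seq x k - seq y k)
  (small-≤ 0 (λ i j _ _ → bound (seq x i) (seq x j) (seq y i) (seq y j))
    (small-+ (cauchy x) (cauchy y)))
  where
  bound : ∀ a b c d → ∣ (a - c) - (b - d) ∣ ≤ ∣ a - b ∣ + ∣ c - d ∣
  bound a b c d = subst (_≤ ∣ a - b ∣ + ∣ c - d ∣)
    (cong ∣_∣ (solve 4 (λ a b c d → (a :- b) :- (c :- d) := (a :- c) :- (b :- d)) refl a b c d))
    (∣p-q∣≤∣p∣+∣q∣ (a - b) (c - d))

∣_∣ᴿ : ℝ → ℝ
∣ x ∣ᴿ = mkℝ (λ k → ∣ seq x k ∣)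
  (small-≤ 0 (λ i j _ _ → ∣∣p∣-∣q∣∣≤∣p-q∣ (seq x i) (seq x j)) (cauchy x))

*-close : ∀ {a b c d p q} → ∣ a ∣ ≤ p → ∣ d ∣ ≤ q →
          ∣ a * c - b * d ∣ ≤ p * ∣ c - d ∣ + q * ∣ a - b ∣
*-close {a} {b} {c} {d} {p} {q} a≤p d≤q = begin
  ∣ a * c - b * d ∣                      ≡⟨ cong ∣_∣ (solve 4 (λ a b c d →
      a :* c :- b :* d := a :* (c :- d) :+ d :* (a :- b)) refl a b c d) ⟩
  ∣ a * (c - d) + d * (a - b) ∣          ≤⟨ ∣p+q∣≤∣p∣+∣q∣ (a * (c - d)) (d * (a - b)) ⟩
  ∣ a * (c - d) ∣ + ∣ d * (a - b) ∣      ≡⟨ cong₂ _+_ (∣p*q∣≡∣p∣*∣q∣ a (c - d)) (∣p*q∣≡∣p∣*∣q∣ d (a - b)) ⟩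
  ∣ a ∣ * ∣ c - d ∣ + ∣ d ∣ * ∣ a - b ∣  ≤⟨ +-mono-≤ (*-monoʳ (0≤∣p∣ (c - d)) a≤p) (*-monoʳ (0≤∣p∣ (a - b)) d≤q) ⟩
  p * ∣ c - d ∣ + q * ∣ a - b ∣          ∎
  where open ≤-Reasoning

cauchy-* : ∀ x y b c M N → (∀ k → M ℕ.≤ k → ∣ x k ∣ ≤ b) → (∀ k → N ℕ.≤ k → ∣ y k ∣ ≤ c) →
           Cauchy x → Cauchy y → Cauchy (λ k → x k * y k)
cauchy-* x y b c M N x≤b y≤c cx cy =
  small-≤ {D} {λ i j → E i j + F i j} (M ℕ.⊔ N) close (small-+ {E} {F} sE sF)
  where
  D E F : ℕ → ℕ → ℚ
  D i j = ∣ x i * y i - x j * y j ∣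
  E i j = b * ∣ y i - y j ∣
  F i j = c * ∣ x i - x j ∣
  close : ∀ i j → M ℕ.⊔ N ℕ.≤ i → M ℕ.⊔ N ℕ.≤ j → D i j ≤ E i j + F i j
  close i j h h′ = *-close {x i} {x j} {y i} {y j} {b} {c}
    (x≤b i (ℕ.m⊔n≤o⇒m≤o M N h)) (y≤c j (ℕ.m⊔n≤o⇒n≤o M N h′))
  sE : Small E
  sE = small-* {λ i j → ∣ y i - y j ∣} b cy (λ i j → 0≤∣p∣ (y i - y j))
  sF : Small F
  sF = small-* {λ i j → ∣ x i - x j ∣} c cx (λ i j → 0≤∣p∣ (x i - x j))

_*ᴿ_ : ℝ → ℝ → ℝ
x *ᴿ y = mkℝ (λ k → seq x k * seq y k)
  (let b , M , x≤b = bounded x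
       c , N , y≤c = bounded y
   in cauchy-* (seq x) (seq y) (fromℕ b) (fromℕ c) M N x≤b y≤c (cauchy x) (cauchy y))

-- Total reciprocal with recip 0 = 0.  A real x # 0 has only finitely many zero
-- approximants, so this convention does not affect the real number x⁻¹.
recip : ℚ → ℚ
recip q with q ≟ 0ℚ
... | yes _   = 0ℚ
... | no  q≢0 = (1/ q) {{≢-nonZero q≢0}}

recip-inverse : ∀ {q} → q ≢ 0ℚ → q * recip q ≡ 1ℚ
recip-inverse {q} q≢0 with q ≟ 0ℚ
... | yes q≡0 = contradiction q≡0 q≢0
... | no  q≢0 = *-inverseʳ q {{≢-nonZero q≢0}}

∣recip∣≤ : ∀ {δ q} (0<δ : 0ℚ < δ) → δ ≤ ∣ q ∣ → ∣ recip q ∣ ≤ (1/ δ) {{>-nonZero 0<δ}}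
∣recip∣≤ {δ} {q} 0<δ δ≤∣q∣ = *-cancelˡ-≤-pos δ {{positive 0<δ}} (begin
  δ * ∣ recip q ∣        ≤⟨ *-monoʳ (0≤∣p∣ (recip q)) δ≤∣q∣ ⟩
  ∣ q ∣ * ∣ recip q ∣    ≡⟨ sym (∣p*q∣≡∣p∣*∣q∣ q (recip q)) ⟩
  ∣ q * recip q ∣        ≡⟨ cong ∣_∣ (recip-inverse q≢0) ⟩
  1ℚ                     ≡⟨ sym (*-inverseʳ δ {{>-nonZero 0<δ}}) ⟩
  δ * (1/ δ) {{_}}       ∎)
  where
  open ≤-Reasoning
  q≢0 : q ≢ 0ℚ
  q≢0 refl = <-irrefl refl (<-≤-trans 0<δ δ≤∣q∣)

recip-close : ∀ {δ p q} (0<δ : 0ℚ < δ) → δ ≤ ∣ p ∣ → δ ≤ ∣ q ∣ →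
  let d = (1/ δ) {{>-nonZero 0<δ}} in ∣ recip p - recip q ∣ ≤ (d * d) * ∣ p - q ∣
recip-close {δ} {p} {q} 0<δ δ≤∣p∣ δ≤∣q∣ = begin
  ∣ recip p - recip q ∣                     ≡⟨ cong ∣_∣ eq ⟩
  ∣ (recip p * recip q) * (q - p) ∣         ≡⟨ ∣p*q∣≡∣p∣*∣q∣ (recip p * recip q) (q - p) ⟩
  ∣ recip p * recip q ∣ * ∣ q - p ∣         ≡⟨ cong₂ _*_ (∣p*q∣≡∣p∣*∣q∣ (recip p) (recip q)) (∣-∣-comm q p) ⟩
  (∣ recip p ∣ * ∣ recip q ∣) * ∣ p - q ∣   ≤⟨ *-monoʳ (0≤∣p∣ (p - q))
      (*-mono (≤-trans (0≤∣p∣ (recip p)) p⁻¹≤d) (0≤∣p∣ (recip q)) p⁻¹≤d (∣recip∣≤ 0<δ δ≤∣q∣)) ⟩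
  (d * d) * ∣ p - q ∣                       ∎
  where
  open ≤-Reasoning
  d : ℚ
  d = (1/ δ) {{>-nonZero 0<δ}}
  p⁻¹≤d : ∣ recip p ∣ ≤ d
  p⁻¹≤d = ∣recip∣≤ 0<δ δ≤∣p∣
  ≢0 : ∀ r → δ ≤ ∣ r ∣ → r ≢ 0ℚ
  ≢0 r δ≤∣r∣ refl = <-irrefl refl (<-≤-trans 0<δ δ≤∣r∣)
  expand : ∀ p q u v → u * (q * v) - v * (p * u) ≡ (u * v) * (q - p)
  expand = solve 4 (λ p q u v → u :* (q :* v) :- v :* (p :* u) := (u :* v) :* (q :- p)) refl
  unitʳ : ∀ u r → r * recip r ≡ 1ℚ → u ≡ u * (r * recip r)
  unitʳ u r e = trans (sym (*-identityʳ u)) (cong (u *_) (sym e))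
  eq : recip p - recip q ≡ (recip p * recip q) * (q - p)
  eq = trans
    (cong₂ _-_ (unitʳ (recip p) q (recip-inverse (≢0 q δ≤∣q∣)))
               (unitʳ (recip q) p (recip-inverse (≢0 p δ≤∣p∣))))
    (expand p q (recip p) (recip q))

#0⇒bounded-below : ∀ x → x # 0ᴿ →
  ∃[ δ ] 0ℚ < δ × ∃[ N ] (∀ k → N ℕ.≤ k → δ ≤ ∣ seq x k ∣)
#0⇒bounded-below x (inj₁ (δ , 0<δ , N , x+δ≤0)) = δ , 0<δ , N , λ k h →
  ≤-trans (subst₂ _≤_ (solve 2 (λ a δ → (a :+ δ) :- a := δ) refl (seq x k) δ)
                      (+-identityˡ (- seq x k)) (+-monoˡ-≤ (- seq x k) (x+δ≤0 k h)))
          (subst (- seq x k ≤_) (∣-p∣≡∣p∣ (seq x k)) (p≤∣p∣ (- seq x k)))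
#0⇒bounded-below x (inj₂ (δ , 0<δ , N , 0+δ≤x)) = δ , 0<δ , N , λ k h →
  ≤-trans (subst (_≤ seq x k) (+-identityˡ δ) (0+δ≤x k h)) (p≤∣p∣ (seq x k))

cauchy-recip : ∀ x δ N → 0ℚ < δ → (∀ k → N ℕ.≤ k → δ ≤ ∣ x k ∣) →
               Cauchy x → Cauchy (λ k → recip (x k))
cauchy-recip x δ N 0<δ δ≤x cx = small-≤ {D} {λ i j → d * d * ∣ x i - x j ∣} N
  (λ i j h h′ → recip-close {δ} {x i} {x j} 0<δ (δ≤x i h) (δ≤x j h′))
  (small-* {λ i j → ∣ x i - x j ∣} (d * d) cx (λ i j → 0≤∣p∣ (x i - x j)))
  where
  d : ℚ
  d = (1/ δ) {{>-nonZero 0<δ}}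
  D : ℕ → ℕ → ℚ
  D i j = ∣ recip (x i) - recip (x j) ∣

_⁻¹ᴿ : (x : ℝ) → x # 0ᴿ → ℝ
(x ⁻¹ᴿ) x#0 = mkℝ (λ k → recip (seq x k))
  (let δ , 0<δ , N , δ≤x = #0⇒bounded-below x x#0
   in cauchy-recip (seq x) δ N 0<δ δ≤x (cauchy x))

divᴿ : (x y : ℝ) → y # 0ᴿ → ℝ
divᴿ x y y#0 = x *ᴿ (y ⁻¹ᴿ) y#0

-- xⁱ / i!
expTerm : ℚ → ℕ → ℚ
expTerm x zero    = 1ℚ
expTerm x (suc i) = expTerm x i * (x * unit i)

-- Σ_{i ≤ k} xⁱ / i!
expSum : ℚ → ℕ → ℚ
expSum x zero    = expTerm x zero
expSum x (suc k) = expSum x k + expTerm x (suc k)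

expTerm-nonNeg : ∀ {x} → 0ℚ ≤ x → ∀ i → 0ℚ ≤ expTerm x i
expTerm-nonNeg 0≤x zero    = nonNegative⁻¹ 1ℚ
expTerm-nonNeg 0≤x (suc i) = 0≤* (expTerm-nonNeg 0≤x i) (0≤* 0≤x (0≤unit i))

expTerm-bound : ∀ {a b} → ∣ a ∣ ≤ b → ∀ i → ∣ expTerm a i ∣ ≤ expTerm b i
expTerm-bound a≤b zero = ≤-refl
expTerm-bound {a} {b} a≤b (suc i) = begin
  ∣ expTerm a i * (a * unit i) ∣          ≡⟨ ∣p*q∣≡∣p∣*∣q∣ (expTerm a i) (a * unit i) ⟩
  ∣ expTerm a i ∣ * ∣ a * unit i ∣        ≡⟨ cong (∣ expTerm a i ∣ *_)
      (trans (∣p*q∣≡∣p∣*∣q∣ a (unit i)) (cong (∣ a ∣ *_) (0≤p⇒∣p∣≡p (0≤unit i)))) ⟩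
  ∣ expTerm a i ∣ * (∣ a ∣ * unit i)      ≤⟨ *-mono
      (expTerm-nonNeg (≤-trans (0≤∣p∣ a) a≤b) i) (0≤* (0≤∣p∣ a) (0≤unit i))
      (expTerm-bound a≤b i) (*-monoʳ (0≤unit i) a≤b) ⟩
  expTerm b i * (b * unit i)              ∎
  where open ≤-Reasoning

expTerm-lipschitz : ∀ {a a′ b} → ∣ a ∣ ≤ b → ∣ a′ ∣ ≤ b → ∀ i →
  ∣ expTerm a (suc i) - expTerm a′ (suc i) ∣ ≤ expTerm b i * ∣ a - a′ ∣
expTerm-lipschitz {a} {a′} {b} a≤b a′≤b zero = ≤-reflexive (trans
  (cong ∣_∣ (solve 2 (λ a a′ → con 1ℚ :* (a :* con 1ℚ) :- con 1ℚ :* (a′ :* con 1ℚ)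
    := a :- a′) refl a a′)) (sym (*-identityˡ ∣ a - a′ ∣)))
expTerm-lipschitz {a} {a′} {b} a≤b a′≤b (suc i) = begin
  ∣ s * (a * u) - s′ * (a′ * u) ∣         ≡⟨ cong ∣_∣ (solve 5 (λ a a′ s s′ u →
      s :* (a :* u) :- s′ :* (a′ :* u) := (a :* s :- a′ :* s′) :* u) refl a a′ s s′ u) ⟩
  ∣ (a * s - a′ * s′) * u ∣               ≡⟨ trans (∣p*q∣≡∣p∣*∣q∣ (a * s - a′ * s′) u)
      (cong (∣ a * s - a′ * s′ ∣ *_) (0≤p⇒∣p∣≡p (0≤unit (suc i)))) ⟩
  ∣ a * s - a′ * s′ ∣ * u                 ≤⟨ *-monoʳ (0≤unit (suc i))
      (*-close {a} {a′} {s} {s′} a≤b (expTerm-bound a′≤b (suc i))) ⟩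
  (b * ∣ s - s′ ∣ + t * v * ∣ a - a′ ∣) * u ≤⟨ *-monoʳ (0≤unit (suc i)) (+-monoˡ-≤ (t * v * ∣ a - a′ ∣)
      (*-monoˡ (≤-trans (0≤∣p∣ a) a≤b) (expTerm-lipschitz a≤b a′≤b i))) ⟩
  (b * (t * ∣ a - a′ ∣) + t * v * ∣ a - a′ ∣) * u ≡⟨ cong (λ z → (z + t * v * ∣ a - a′ ∣) * u) eq₁ ⟩
  (n * (t * v * ∣ a - a′ ∣) + t * v * ∣ a - a′ ∣) * u ≡⟨ solve 3 (λ n z u →
      (n :* z :+ z) :* u := z :* ((con 1ℚ :+ n) :* u)) refl n (t * v * ∣ a - a′ ∣) u ⟩
  (t * v * ∣ a - a′ ∣) * ((1ℚ + n) * u)   ≡⟨ cong (t * v * ∣ a - a′ ∣ *_)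
      (trans (cong (_* u) (sym (fromℕ-suc (suc i)))) (fromℕ*unit (suc i))) ⟩
  (t * v * ∣ a - a′ ∣) * 1ℚ               ≡⟨ *-identityʳ _ ⟩
  t * v * ∣ a - a′ ∣                      ∎
  where
  open ≤-Reasoning
  s s′ t u v n : ℚ
  s  = expTerm a (suc i)
  s′ = expTerm a′ (suc i)
  t  = expTerm b i
  u  = unit (suc i)
  v  = b * unit i
  n  = fromℕ (suc i)
  eq₁ : b * (t * ∣ a - a′ ∣) ≡ n * (t * v * ∣ a - a′ ∣)
  eq₁ = trans (sym (*-identityˡ _)) (trans
    (cong (_* (b * (t * ∣ a - a′ ∣))) (sym (fromℕ*unit i)))
    (solve 5 (λ n w b t d → (n :* w) :* (b :* (t :* d)) := n :* (t :* (b :* w) :* d)) refl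
      n (unit i) b t ∣ a - a′ ∣))

expSum-lipschitz : ∀ {a a′ b} → ∣ a ∣ ≤ b → ∣ a′ ∣ ≤ b → ∀ k →
  ∣ expSum a k - expSum a′ k ∣ ≤ expSum b k * ∣ a - a′ ∣
expSum-lipschitz {a} {a′} {b} a≤b a′≤b k = ≤-trans (strong k)
  (*-monoʳ (0≤∣p∣ (a - a′)) (pred≤ k))
  where
  0≤b : 0ℚ ≤ b
  0≤b = ≤-trans (0≤∣p∣ a) a≤b
  S : ℕ → ℚ
  S zero    = 0ℚ
  S (suc k) = expSum b k
  pred≤ : ∀ k → S k ≤ expSum b k
  pred≤ zero    = nonNegative⁻¹ 1ℚ
  pred≤ (suc k) = p≤p+q (expTerm-nonNeg 0≤b (suc k))
  S-suc : ∀ k → S k + expTerm b k ≡ expSum b k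
  S-suc zero    = refl
  S-suc (suc k) = refl
  strong : ∀ k → ∣ expSum a k - expSum a′ k ∣ ≤ S k * ∣ a - a′ ∣
  strong zero = ≤-reflexive (sym (*-zeroˡ ∣ a - a′ ∣))
  strong (suc k) = begin
    ∣ (p + q) - (p′ + q′) ∣      ≡⟨ cong ∣_∣ (solve 4 (λ p q p′ q′ →
        (p :+ q) :- (p′ :+ q′) := (p :- p′) :+ (q :- q′)) refl p q p′ q′) ⟩
    ∣ (p - p′) + (q - q′) ∣      ≤⟨ ∣p+q∣≤∣p∣+∣q∣ (p - p′) (q - q′) ⟩
    ∣ p - p′ ∣ + ∣ q - q′ ∣      ≤⟨ +-mono-≤ (strong k) (expTerm-lipschitz a≤b a′≤b k) ⟩
    S k * ∣ a - a′ ∣ + expTerm b k * ∣ a - a′ ∣ ≡⟨ sym (*-distribʳ-+ ∣ a - a′ ∣ (S k) (expTerm b k)) ⟩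
    (S k + expTerm b k) * ∣ a - a′ ∣ ≡⟨ cong (_* ∣ a - a′ ∣) (S-suc k) ⟩
    expSum b k * ∣ a - a′ ∣      ∎
    where
    open ≤-Reasoning
    p q p′ q′ : ℚ
    p  = expSum a k
    q  = expTerm a (suc k)
    p′ = expSum a′ k
    q′ = expTerm a′ (suc k)

expSum-step : ∀ {a b} → ∣ a ∣ ≤ b → ∀ j d →
  ∣ expSum a (d ℕ.+ j) - expSum a j ∣ ≤ expSum b (d ℕ.+ j) - expSum b j
expSum-step {a} {b} a≤b j zero = ≤-reflexive
  (trans (cong ∣_∣ (+-inverseʳ (expSum a j))) (sym (+-inverseʳ (expSum b j))))
expSum-step {a} {b} a≤b j (suc d) = begin
  ∣ (p + q) - r ∣          ≡⟨ cong ∣_∣ (rearrange p q r) ⟩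
  ∣ (p - r) + q ∣          ≤⟨ ∣p+q∣≤∣p∣+∣q∣ (p - r) q ⟩
  ∣ p - r ∣ + ∣ q ∣        ≤⟨ +-mono-≤ (expSum-step a≤b j d) (expTerm-bound a≤b (suc (d ℕ.+ j))) ⟩
  (expSum b (d ℕ.+ j) - expSum b j) + expTerm b (suc (d ℕ.+ j))
                           ≡⟨ sym (rearrange (expSum b (d ℕ.+ j)) (expTerm b (suc (d ℕ.+ j))) (expSum b j)) ⟩
  (expSum b (d ℕ.+ j) + expTerm b (suc (d ℕ.+ j))) - expSum b j ∎
  where
  open ≤-Reasoning
  p q r : ℚ
  p = expSum a (d ℕ.+ j)
  q = expTerm a (suc (d ℕ.+ j))
  r = expSum a j
  rearrange : ∀ p q r → (p + q) - r ≡ (p - r) + q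
  rearrange = solve 3 (λ p q r → (p :+ q) :- r := (p :- r) :+ q) refl

expSum-tail : ∀ {a b} → ∣ a ∣ ≤ b → ∀ i j →
  ∣ expSum a i - expSum a j ∣ ≤ ∣ expSum b i - expSum b j ∣
expSum-tail {a} {b} a≤b i j with ℕ.≤-total j i
... | inj₁ j≤i = subst (λ i → ∣ expSum a i - expSum a j ∣ ≤ ∣ expSum b i - expSum b j ∣)
  (ℕ.m∸n+n≡m j≤i) (≤-trans (expSum-step a≤b j (i ℕ.∸ j)) (p≤∣p∣ _))
... | inj₂ i≤j = subst₂ _≤_ (∣-∣-comm (expSum a j) (expSum a i)) (∣-∣-comm (expSum b j) (expSum b i))
  (subst (λ j → ∣ expSum a j - expSum a i ∣ ≤ ∣ expSum b j - expSum b i ∣)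
    (ℕ.m∸n+n≡m i≤j) (≤-trans (expSum-step a≤b i (j ℕ.∸ i)) (p≤∣p∣ _)))

-- For i ≥ 2b the terms bⁱ/i! at least halve at every step.
module Tail (b : ℕ) where

  β : ℚ
  β = fromℕ b

  K : ℕ
  K = b ℕ.+ b

  t : ℕ → ℚ
  t = expTerm β

  0≤t : ∀ i → 0ℚ ≤ t i
  0≤t = expTerm-nonNeg (0≤fromℕ b)

  fromℕ-+ : ∀ m n → fromℕ (m ℕ.+ n) ≡ fromℕ m + fromℕ n
  fromℕ-+ zero    n = sym (+-identityˡ (fromℕ n))
  fromℕ-+ (suc m) n = trans (fromℕ-suc (m ℕ.+ n)) (trans (cong (λ z → 1ℚ + z) (fromℕ-+ m n))
    (trans (sym (+-assoc 1ℚ (fromℕ m) (fromℕ n))) (cong (_+ fromℕ n) (sym (fromℕ-suc m)))))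

  halve : ∀ i → K ℕ.≤ i → t (suc i) + t (suc i) ≤ t i
  halve i K≤i = begin
    t (suc i) + t (suc i)          ≡⟨ solve 3 (λ t b u → t :* (b :* u) :+ t :* (b :* u)
                                        := t :* ((b :+ b) :* u)) refl (t i) β (unit i) ⟩
    t i * ((β + β) * unit i)       ≡⟨ cong (λ z → t i * (z * unit i)) (sym (fromℕ-+ b b)) ⟩
    t i * (fromℕ K * unit i)       ≤⟨ *-monoˡ (0≤t i) (*-monoʳ (0≤unit i)
                                        (fromℕ-mono (ℕ.≤-trans K≤i (ℕ.n≤1+n i)))) ⟩
    t i * (fromℕ (suc i) * unit i) ≡⟨ cong (t i *_) (fromℕ*unit i) ⟩
    t i * 1ℚ                       ≡⟨ *-identityʳ (t i) ⟩
    t i                            ∎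
    where open ≤-Reasoning

  sum-bound : ∀ j → K ℕ.≤ j → ∀ d → expSum β (d ℕ.+ j) + t (d ℕ.+ j) ≤ expSum β j + t j
  sum-bound j K≤j zero    = ≤-refl
  sum-bound j K≤j (suc d) = ≤-trans (≤-trans
    (≤-reflexive (+-assoc (expSum β (d ℕ.+ j)) (t (suc (d ℕ.+ j))) (t (suc (d ℕ.+ j)))))
    (+-monoʳ-≤ (expSum β (d ℕ.+ j)) (halve (d ℕ.+ j) (ℕ.≤-trans K≤j (ℕ.m≤n+m j d)))))
    (sum-bound j K≤j d)

  decay : ∀ d → fromℕ (suc d) * t (d ℕ.+ K) ≤ t K
  decay zero    = ≤-reflexive (*-identityˡ (t K))
  decay (suc d) = begin
    fromℕ (suc (suc d)) * t (suc (d ℕ.+ K))          ≤⟨ *-monoʳ (0≤t (suc (d ℕ.+ K)))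
        (fromℕ-mono (ℕ.s≤s (ℕ.m≤n+m (suc d) d))) ⟩
    fromℕ (suc d ℕ.+ suc d) * t (suc (d ℕ.+ K))      ≡⟨ cong (_* t (suc (d ℕ.+ K))) (fromℕ-+ (suc d) (suc d)) ⟩
    (fromℕ (suc d) + fromℕ (suc d)) * t (suc (d ℕ.+ K)) ≡⟨ solve 2 (λ n t →
        (n :+ n) :* t := n :* (t :+ t)) refl (fromℕ (suc d)) (t (suc (d ℕ.+ K))) ⟩
    fromℕ (suc d) * (t (suc (d ℕ.+ K)) + t (suc (d ℕ.+ K))) ≤⟨ *-monoˡ (0≤fromℕ (suc d))
        (halve (d ℕ.+ K) (ℕ.m≤n+m K d)) ⟩
    fromℕ (suc d) * t (d ℕ.+ K)                      ≤⟨ decay d ⟩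
    t K                                              ∎
    where open ≤-Reasoning

  sum-diff : ∀ j → K ℕ.≤ j → ∀ d → ∣ expSum β (d ℕ.+ j) - expSum β j ∣ ≤ t j
  sum-diff j K≤j d = ≤-trans (expSum-step (≤-reflexive (0≤p⇒∣p∣≡p (0≤fromℕ b))) j d)
    (p≤q+r⇒p-q≤r {expSum β (d ℕ.+ j)} {expSum β j} {t j}
      (≤-trans (p≤p+q {expSum β (d ℕ.+ j)} (0≤t (d ℕ.+ j))) (sum-bound j K≤j d)))

  S-bounded′ : ∀ d → expSum β (d ℕ.+ K) ≤ expSum β K + t K
  S-bounded′ d = ≤-trans (p≤p+q {expSum β (d ℕ.+ K)} (0≤t (d ℕ.+ K))) (sum-bound K ℕ.≤-refl d)

  S-bounded : ∀ k → K ℕ.≤ k → expSum β k ≤ expSum β K + t K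
  S-bounded k K≤k = subst (λ k → expSum β k ≤ expSum β K + t K) (ℕ.m∸n+n≡m K≤k) (S-bounded′ (k ℕ.∸ K))

  t-small : ∀ ε → 0ℚ < ε → ∃[ N ] K ℕ.≤ N × (∀ j → N ℕ.≤ j → t j < ε)
  t-small ε 0<ε = n ℕ.+ K , ℕ.m≤n+m K n , λ j h → subst (λ j → t j < ε)
      (ℕ.m∸n+n≡m (ℕ.≤-trans (ℕ.m≤n+m K n) h))
      (below (j ℕ.∸ K) (subst (ℕ._≤ j ℕ.∸ K) (ℕ.m+n∸n≡m n K) (ℕ.∸-monoˡ-≤ K h)))
    where
    instance ε≢0 = >-nonZero 0<ε
    n : ℕ
    n = proj₁ (archimedean (t K * (1/ ε)))
    tK≤nε : t K ≤ fromℕ n * ε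
    tK≤nε = subst (_≤ fromℕ n * ε)
      (trans (*-assoc (t K) (1/ ε) ε) (trans (cong (t K *_) (*-inverseˡ ε)) (*-identityʳ (t K))))
      (*-monoʳ (<⇒≤ 0<ε) (proj₂ (archimedean (t K * (1/ ε)))))
    n<1+d : ∀ d → n ℕ.≤ d → fromℕ n * ε < fromℕ (suc d) * ε
    n<1+d d n≤d = *-monoˡ-<-pos ε {{positive 0<ε}}
      (≤-<-trans (fromℕ-mono n≤d) (subst (fromℕ d <_) (sym (fromℕ-suc d))
        (subst (_< 1ℚ + fromℕ d) (+-identityˡ (fromℕ d)) (+-monoˡ-< (fromℕ d) (positive⁻¹ 1ℚ)))))
    below : ∀ d → n ℕ.≤ d → t (d ℕ.+ K) < ε
    below d n≤d = *-cancelˡ-<-nonNeg (fromℕ (suc d)) {{nonNegative (0≤fromℕ (suc d))}}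
      (≤-<-trans (decay d) (≤-<-trans tK≤nε (n<1+d d n≤d)))

  S-close : ∀ ε N → K ℕ.≤ N → (∀ j → N ℕ.≤ j → t j < ε) →
            ∀ i j → N ℕ.≤ j → j ℕ.≤ i → ∣ expSum β i - expSum β j ∣ < ε
  S-close ε N K≤N t<ε i j N≤j j≤i = subst (λ i → ∣ expSum β i - expSum β j ∣ < ε) (ℕ.m∸n+n≡m j≤i)
    (≤-<-trans (sum-diff j (ℕ.≤-trans K≤N N≤j) (i ℕ.∸ j)) (t<ε j N≤j))

  S-cauchy : Cauchy (expSum β)
  S-cauchy ε 0<ε = N , λ i j h h′ → go i j h h′ (ℕ.≤-total j i)
    where
    N : ℕ
    N = proj₁ (t-small ε 0<ε)
    close : ∀ i j → N ℕ.≤ j → j ℕ.≤ i → ∣ expSum β i - expSum β j ∣ < ε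
    close = S-close ε N (proj₁ (proj₂ (t-small ε 0<ε))) (proj₂ (proj₂ (t-small ε 0<ε)))
    go : ∀ i j → N ℕ.≤ i → N ℕ.≤ j → j ℕ.≤ i ⊎ i ℕ.≤ j → ∣ expSum β i - expSum β j ∣ < ε
    go i j h h′ (inj₁ j≤i) = close i j h′ j≤i
    go i j h h′ (inj₂ i≤j) = subst (_< ε) (∣-∣-comm (expSum β j) (expSum β i)) (close j i h i≤j)

cauchy-exp : ∀ x b N → (∀ k → N ℕ.≤ k → ∣ x k ∣ ≤ fromℕ b) →
             Cauchy x → Cauchy (λ k → expSum (x k) k)
cauchy-exp x b N x≤b cx =
  small-≤ {D} {λ i j → E i j + F i j} (N ℕ.⊔ K) close (small-+ {E} {F} S-cauchy sF)
  where
  open Tail b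
  D E F : ℕ → ℕ → ℚ
  D i j = ∣ expSum (x i) i - expSum (x j) j ∣
  E i j = ∣ expSum β i - expSum β j ∣
  F i j = (expSum β K + t K) * ∣ x i - x j ∣
  sF : Small F
  sF = small-* {λ i j → ∣ x i - x j ∣} (expSum β K + t K) cx (λ i j → 0≤∣p∣ (x i - x j))
  close : ∀ i j → N ℕ.⊔ K ℕ.≤ i → N ℕ.⊔ K ℕ.≤ j → D i j ≤ E i j + F i j
  close i j h h′ = ≤-trans
    (∣-∣-triangle (expSum (x i) i) (expSum (x i) j) (expSum (x j) j))
    (+-mono-≤
      (expSum-tail (x≤b i (ℕ.m⊔n≤o⇒m≤o N K h)) i j)
      (≤-trans
        (expSum-lipschitz (x≤b i (ℕ.m⊔n≤o⇒m≤o N K h)) (x≤b j (ℕ.m⊔n≤o⇒m≤o N K h′)) j)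
        (*-monoʳ (0≤∣p∣ (x i - x j)) (S-bounded j (ℕ.m⊔n≤o⇒n≤o N K h′)))))

-- exp x = Σ xⁱ / i!: the k-th approximation is the k-th partial sum of the
-- series at the k-th approximation of x.
exp : ℝ → ℝ
exp x = mkℝ (λ k → expSum (seq x k) k)
  (let b , N , x≤b = bounded x in cauchy-exp (seq x) b N x≤b (cauchy x))

-- ℓ is the natural logarithm of y, i.e. the (unique) solution of exp ℓ = y.
IsLog : ℝ → ℝ → Set
IsLog y ℓ = exp ℓ ≃ᴿ y

infix 4 _∼_

-- lim f(n)/g(n) = 1: for all large n the quotient is defined and close to 1.
-- By density of ℚ it is enough to let ε range over the positive rationals.
_∼_ : (f g : ℕ → ℝ) → Set
f ∼ g = ∀ (ε : ℚ) → 0ℚ < ε → ∃[ N ] (∀ n → N ℕ.≤ n →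
  Σ (g n # 0ᴿ) λ gn#0 → ∣ divᴿ (f n) (g n) gn#0 -ᴿ 1ᴿ ∣ᴿ <ᴿ fromℚ ε)

{-# OPTIONS --safe #-}
module Submission where

-- Fix m ≥ 1 and let T be the operator (T φ) r = φ r + φ (r + 1) of Pascal's triangle.
-- Applied N times to the indicator function of the multiples of m it gives, at r = 0, the
-- sum of N C j over the multiples j of m (iter-binomial, iter-multiple).  All iterates have
-- period m, and the m values in a period of the N-th one add up to 2 ^ N (window-iter).
-- It remains to see that these values become equal relative to 2 ^ N.  In T ^ m φ every one
-- of the m values of φ in a period occurs with a positive coefficient, so one copy of their
-- sum splits off; it does not depend on r, and the remaining coefficients add up to 2 ^ m - m.
-- Hence T ^ m multiplies the oscillation by at most 2 ^ m - m while the mean grows by the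
-- factor 2 ^ m (iter-contract).  So m times the binomial sum differs from 2 ^ (m * n) by at
-- most m * (2 ^ m - m) ^ n (iter-close), which Bernoulli's inequality turns into a relative
-- error of size 1 / n (binomialSum-close).
--
-- On the analytic side, log 2 is constructed by searching, for every degree k, a grid of
-- mesh 1 / k for the point where the k-th partial sum of the exponential series passes 2
-- (log2-approx).  The identity exp (N * log 2) = 2 ^ N (exp-log2-power) follows from the
-- functional equation exp-+.  For that, the binomial theorem identifies the partial sum at
-- x + y with the part i + j ≤ k of the product of the partial sums at x and y; the other
-- part is dominated by a tail of an exponential series (expSum-+-close).
-- div-close combines the two sides.

open import Data.Product using (Σ; ∃-syntax; _×_; _,_; proj₁; proj₂)
open import Data.Sum.Base using (_⊎_; inj₁; inj₂)
open import Function.Base using (_∘_)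
open import Relation.Binary.PropositionalEquality
  using (_≡_; _≢_; refl; sym; trans; cong; cong₂; subst; subst₂; module ≡-Reasoning)
open import Relation.Nullary using (contradiction)
open import Defs

-- Binomial coefficients along an arithmetic progression

module BinomialSum where

  open import Data.List.Base using (map; sum; upTo; applyUpTo)
  open import Data.List.Properties using (map-upTo)
  open import Data.Nat.Combinatorics using (_C_; nCk+nC[k+1]≡[n+1]C[k+1]; k>n⇒nCk≡0)
  open import Data.Nat.Base
  open import Data.Nat.DivMod using (_%_; [m+n]%n≡m%n; [m+kn]%n≡m%n; m<n⇒m%n≡m)
  open import Data.Nat.Properties
  open import Data.Nat.Tactic.RingSolver using (solve-∀)

  private
    interchange : ∀ a b c d → a + b + (c + d) ≡ a + c + (b + d)
    interchange = solve-∀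

    double : ∀ p c → p * c + p * c ≡ 2 * p * c
    double = solve-∀

  -- The sum of f i over i < n.
  ∑ : ℕ → (ℕ → ℕ) → ℕ
  ∑ n f = sum (applyUpTo f n)

  ∑-cong : ∀ n {f g} → (∀ i → i < n → f i ≡ g i) → ∑ n f ≡ ∑ n g
  ∑-cong zero    f≗g = refl
  ∑-cong (suc n) f≗g = cong₂ _+_ (f≗g 0 (s≤s z≤n)) (∑-cong n (λ i i<n → f≗g (suc i) (s≤s i<n)))

  ∑-+ : ∀ n f g → ∑ n (λ i → f i + g i) ≡ ∑ n f + ∑ n g
  ∑-+ zero    f g = refl
  ∑-+ (suc n) f g = trans (cong (f 0 + g 0 +_) (∑-+ n (f ∘ suc) (g ∘ suc)))
    (interchange (f 0) (g 0) (∑ n (f ∘ suc)) (∑ n (g ∘ suc)))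

  ∑-const : ∀ n c → ∑ n (λ _ → c) ≡ n * c
  ∑-const zero    c = refl
  ∑-const (suc n) c = cong (c +_) (∑-const n c)

  ∑-zero : ∀ n {f} → (∀ i → i < n → f i ≡ 0) → ∑ n f ≡ 0
  ∑-zero n f≗0 = trans (∑-cong n f≗0) (trans (∑-const n 0) (*-zeroʳ n))

  ∑-++ : ∀ a b f → ∑ (a + b) f ≡ ∑ a f + ∑ b (λ i → f (a + i))
  ∑-++ zero    b f = refl
  ∑-++ (suc a) b f = trans (cong (f 0 +_) (∑-++ a b (f ∘ suc))) (sym (+-assoc (f 0) _ _))

  ∑-blocks : ∀ n m f → ∑ (n * m) f ≡ ∑ n (λ k → ∑ m (λ i → f (k * m + i)))
  ∑-blocks zero    m f = refl
  ∑-blocks (suc n) m f = trans (∑-++ m (n * m) f)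
    (cong (∑ m f +_) (trans (∑-blocks n m (λ i → f (m + i)))
      (∑-cong n λ k _ → ∑-cong m λ i _ → cong f (sym (+-assoc m (k * m) i)))))

  -- Iterates of Pascal's rule

  -- One step of Pascal's rule, as an operator on sequences of natural numbers.
  pascal : (ℕ → ℕ) → ℕ → ℕ
  pascal φ r = φ r + φ (suc r)

  -- The k-th power of the operator pascal.
  iter : ℕ → (ℕ → ℕ) → ℕ → ℕ
  iter zero    φ = φ
  iter (suc k) φ = pascal (iter k φ)

  iter-+ : ∀ a b φ r → iter (a + b) φ r ≡ iter a (iter b φ) r
  iter-+ zero    b φ r = refl
  iter-+ (suc a) b φ r = cong₂ _+_ (iter-+ a b φ r) (iter-+ a b φ (suc r))

  iter-const : ∀ k c r → iter k (λ _ → c) r ≡ 2 ^ k * c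
  iter-const zero    c r = sym (*-identityˡ c)
  iter-const (suc k) c r = trans (cong₂ _+_ (iter-const k c r) (iter-const k c (suc r)))
    (double (2 ^ k) c)

  -- The upper limit M only has to exceed k, because k C j vanishes for j > k.
  -- This slack lets the induction vary M, and later lets M be a multiple of m.
  iter-binomial : ∀ k M φ r → k < M → iter k φ r ≡ ∑ M (λ j → (k C j) * φ (r + j))
  iter-binomial zero (suc M) φ r _ = sym (trans
    (cong₂ _+_ (trans (*-identityˡ _) (cong φ (+-identityʳ r)))
      (∑-zero M λ j _ → cong (_* φ (r + suc j)) (k>n⇒nCk≡0 {0} {suc j} (s≤s z≤n))))
    (+-identityʳ (φ r)))
  iter-binomial (suc k) (suc M) φ r (s≤s k<M) = begin
    iter k φ r + iter k φ (suc r)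
      ≡⟨ cong₂ _+_ (iter-binomial k (suc M) φ r (m<n⇒m<1+n k<M)) (iter-binomial k M φ (suc r) k<M) ⟩
    (k C 0) * φ (r + 0) + ∑ M (λ j → (k C suc j) * φ (r + suc j)) + ∑ M (λ j → (k C j) * φ (suc r + j))
      ≡⟨ +-assoc ((k C 0) * φ (r + 0)) _ _ ⟩
    (k C 0) * φ (r + 0) + (∑ M (λ j → (k C suc j) * φ (r + suc j)) + ∑ M (λ j → (k C j) * φ (suc r + j)))
      -- Both k C 0 and suc k C 0 compute to 1.
      ≡⟨ cong ((suc k C 0) * φ (r + 0) +_) (trans (sym (∑-+ M _ _)) (∑-cong M λ j _ → step j)) ⟩
    (suc k C 0) * φ (r + 0) + ∑ M (λ j → (suc k C suc j) * φ (r + suc j)) ∎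
    where
    open ≡-Reasoning
    step : ∀ j → (k C suc j) * φ (r + suc j) + (k C j) * φ (suc r + j) ≡ (suc k C suc j) * φ (r + suc j)
    step j = begin
      (k C suc j) * φ (r + suc j) + (k C j) * φ (suc r + j)
        ≡⟨ cong (λ i → (k C suc j) * φ (r + suc j) + (k C j) * φ i) (sym (+-suc r j)) ⟩
      (k C suc j) * φ (r + suc j) + (k C j) * φ (r + suc j)
        ≡⟨ sym (*-distribʳ-+ (φ (r + suc j)) (k C suc j) (k C j)) ⟩
      ((k C suc j) + (k C j)) * φ (r + suc j)
        ≡⟨ cong (_* φ (r + suc j)) (trans (+-comm (k C suc j) (k C j)) (nCk+nC[k+1]≡[n+1]C[k+1] k j)) ⟩
      (suc k C suc j) * φ (r + suc j) ∎

  -- Windows and their monotone complement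

  -- φ r + φ (r + 1) + ... + φ (r + k - 1)
  window : (ℕ → ℕ) → ℕ → ℕ → ℕ
  window φ zero    r = 0
  window φ (suc k) r = φ r + window φ k (suc r)

  window-∑ : ∀ φ k r → window φ k r ≡ ∑ k (λ j → φ (r + j))
  window-∑ φ zero    r = refl
  window-∑ φ (suc k) r = cong₂ _+_ (cong φ (sym (+-identityʳ r)))
    (trans (window-∑ φ k (suc r)) (∑-cong k λ j _ → cong φ (sym (+-suc r j))))

  window-last : ∀ φ k r → window φ (suc k) r ≡ window φ k r + φ (k + r)
  window-last φ zero    r = +-identityʳ (φ r)
  window-last φ (suc k) r = trans
    (cong (φ r +_) (trans (window-last φ k (suc r)) (cong (λ i → window φ k (suc r) + φ i) (+-suc k r))))
    (sym (+-assoc (φ r) (window φ k (suc r)) (φ (suc k + r))))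

  window-const : ∀ k c r → window (λ _ → c) k r ≡ k * c
  window-const zero    c r = refl
  window-const (suc k) c r = cong (c +_) (window-const k c (suc r))

  window-mono : ∀ {φ ψ} → (∀ r → φ r ≤ ψ r) → ∀ k r → window φ k r ≤ window ψ k r
  window-mono φ≤ψ zero    r = z≤n
  window-mono φ≤ψ (suc k) r = +-mono-≤ (φ≤ψ r) (window-mono φ≤ψ k (suc r))

  -- What remains of iter k φ after one copy of each of φ r, ..., φ (r + k) is
  -- removed; see iter-window.  It is a combination of values of φ with natural
  -- number coefficients, which is all that is used about it.
  rest : (ℕ → ℕ) → ℕ → ℕ → ℕ
  rest φ zero    r = 0
  rest φ (suc k) r = rest φ k r + rest φ k (suc r) + window φ k (suc r)

  rest-mono : ∀ {φ ψ} → (∀ r → φ r ≤ ψ r) → ∀ k r → rest φ k r ≤ rest ψ k r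
  rest-mono φ≤ψ zero    r = z≤n
  rest-mono φ≤ψ (suc k) r = +-mono-≤
    (+-mono-≤ (rest-mono φ≤ψ k r) (rest-mono φ≤ψ k (suc r))) (window-mono φ≤ψ k (suc r))

  iter-window : ∀ φ k r → iter k φ r ≡ window φ (suc k) r + rest φ k r
  iter-window φ zero    r = sym (trans (+-identityʳ _) (+-identityʳ (φ r)))
  iter-window φ (suc k) r = begin
    iter k φ r + iter k φ (suc r)
      ≡⟨ cong₂ _+_ (iter-window φ k r) (iter-window φ k (suc r)) ⟩
    (φ r + window φ k (suc r)) + rest φ k r + (window φ (suc k) (suc r) + rest φ k (suc r))
      ≡⟨ regroup (φ r) (window φ k (suc r)) (window φ (suc k) (suc r)) (rest φ k r) (rest φ k (suc r)) ⟩
    (φ r + window φ (suc k) (suc r)) + (rest φ k r + rest φ k (suc r) + window φ k (suc r)) ∎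
    where
    open ≡-Reasoning
    regroup : ∀ a u v p q → a + u + p + (v + q) ≡ a + v + (p + q + u)
    regroup = solve-∀

  -- The map sending φ to iter k φ minus window φ k is monotone.  Subtraction is
  -- avoided by moving the negative terms across the inequality.
  iter-window-mono : ∀ {φ ψ} → (∀ r → φ r ≤ ψ r) → ∀ k r →
    iter k φ r + window ψ k r ≤ window φ k r + iter k ψ r
  iter-window-mono {φ} {ψ} φ≤ψ k r = begin
    iter k φ r + window ψ k r
      ≡⟨ cong (_+ window ψ k r) (split φ) ⟩
    window φ k r + (φ (k + r) + rest φ k r) + window ψ k r
      ≤⟨ +-monoˡ-≤ (window ψ k r) (+-monoʳ-≤ (window φ k r) (+-mono-≤ (φ≤ψ (k + r)) (rest-mono φ≤ψ k r))) ⟩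
    window φ k r + (ψ (k + r) + rest ψ k r) + window ψ k r
      ≡⟨ rotate (window φ k r) (ψ (k + r) + rest ψ k r) (window ψ k r) ⟩
    window φ k r + (window ψ k r + (ψ (k + r) + rest ψ k r))
      ≡⟨ cong (window φ k r +_) (sym (split ψ)) ⟩
    window φ k r + iter k ψ r ∎
    where
    open ≤-Reasoning
    split : ∀ χ → iter k χ r ≡ window χ k r + (χ (k + r) + rest χ k r)
    split χ = trans (iter-window χ k r)
      (trans (cong (_+ rest χ k r) (window-last χ k r)) (+-assoc (window χ k r) (χ (k + r)) (rest χ k r)))
    rotate : ∀ a b c → a + b + c ≡ a + (c + b)
    rotate = solve-∀

  -- Contraction of the oscillation of periodic sequences

  -- The number m is a period of φ, not necessarily the least one.
  Periodic : ℕ → (ℕ → ℕ) → Set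
  Periodic m φ = ∀ r → φ (m + r) ≡ φ r

  iter-periodic : ∀ {m φ} → Periodic m φ → ∀ k → Periodic m (iter k φ)
  iter-periodic         per zero    r = per r
  iter-periodic {m} {φ} per (suc k) r = cong₂ _+_ (iter-periodic per k r)
    (trans (cong (iter k φ) (sym (+-suc m r))) (iter-periodic per k (suc r)))

  -- A window as long as the period does not depend on where it starts.
  window-periodic : ∀ {m φ} → Periodic m φ → ∀ r → window φ m r ≡ window φ m 0
  window-periodic         per zero    = refl
  window-periodic {m} {φ} per (suc r) = trans (+-cancelˡ-≡ (φ r) _ _ (trans
      (window-last φ m r) (trans (+-comm _ (φ (m + r))) (cong (_+ window φ m r) (per r)))))
    (window-periodic per r)

  window-pascal : ∀ φ k r → window (pascal φ) k r ≡ window φ k r + window φ k (suc r)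
  window-pascal φ zero    r = refl
  window-pascal φ (suc k) r = trans (cong (pascal φ r +_) (window-pascal φ k (suc r)))
    (interchange (φ r) (φ (suc r)) (window φ k (suc r)) (window φ k (suc (suc r))))

  window-iter : ∀ {m φ} → Periodic m φ → ∀ k → window (iter k φ) m 0 ≡ 2 ^ k * window φ m 0
  window-iter         per zero    = sym (*-identityˡ _)
  window-iter {m} {φ} per (suc k) = begin
    window (iter (suc k) φ) m 0                      ≡⟨ window-pascal (iter k φ) m 0 ⟩
    window (iter k φ) m 0 + window (iter k φ) m 1    ≡⟨ cong (window (iter k φ) m 0 +_)
                                                          (window-periodic (iter-periodic per k) 1) ⟩
    window (iter k φ) m 0 + window (iter k φ) m 0    ≡⟨ cong (λ x → x + x) (window-iter per k) ⟩
    2 ^ k * window φ m 0 + 2 ^ k * window φ m 0      ≡⟨ double (2 ^ k) (window φ m 0) ⟩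
    2 * 2 ^ k * window φ m 0                         ∎
    where
    open ≡-Reasoning

  module _ (m c : ℕ) (c+m≡2^m : c + m ≡ 2 ^ m) where

    private
      below : ∀ {x y k} → x + m * k ≤ y + 2 ^ m * k → x ≤ y + c * k
      below {x} {y} {k} le = +-cancelʳ-≤ (m * k) x (y + c * k) (≤-trans le (≤-reflexive
        (trans (cong (λ z → y + z * k) (sym c+m≡2^m)) (expand y c m k))))
        where
        expand : ∀ y c m k → y + (c + m) * k ≡ y + c * k + m * k
        expand = solve-∀

      above : ∀ {x y k} → 2 ^ m * k + y ≤ m * k + x → y + c * k ≤ x
      above {x} {y} {k} le = +-cancelˡ-≤ (m * k) (y + c * k) x (≤-trans (≤-reflexive
        (trans (sym (expand y c m k)) (cong (λ z → z * k + y) c+m≡2^m))) le)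
        where
        expand : ∀ y c m k → (c + m) * k + y ≡ m * k + (y + c * k)
        expand = solve-∀

    -- If a sequence of period m has its values in an interval of length w, then
    -- iter m maps it to one with values in an interval of length (2^m - m) * w,
    -- rather than 2^m * w.  Here c is 2^m - m.  The bounds compare φ with the constant
    -- sequences lo and lo + w by iter-window-mono.
    iter-contract : ∀ {φ lo w} → Periodic m φ → (∀ r → lo ≤ φ r) → (∀ r → φ r ≤ lo + w) →
      ∃[ lo′ ] (∀ r → lo′ ≤ iter m φ r) × (∀ r → iter m φ r ≤ lo′ + c * w)
    iter-contract {φ} {lo} {w} per lo≤φ φ≤hi = t + c * lo , lower , upper
      where
      t : ℕ
      t = window φ m 0
      lower : ∀ r → t + c * lo ≤ iter m φ r
      lower r = above (subst₂ _≤_ (cong₂ _+_ (iter-const m lo r) (window-periodic per r))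
        (cong (_+ iter m φ r) (window-const m lo r)) (iter-window-mono lo≤φ m r))
      upper : ∀ r → iter m φ r ≤ t + c * lo + c * w
      upper r = ≤-trans (below {iter m φ r} {t} {lo + w} (subst₂ _≤_
          (cong (iter m φ r +_) (window-const m (lo + w) r))
          (cong₂ _+_ (window-periodic per r) (iter-const m (lo + w) r)) (iter-window-mono φ≤hi m r)))
        (≤-reflexive (trans (cong (t +_) (*-distribˡ-+ c lo w)) (sym (+-assoc t (c * lo) (c * w)))))

    iter-spread : ∀ {φ} → Periodic m φ → (∀ r → φ r ≤ 1) → ∀ n →
      ∃[ lo ] (∀ r → lo ≤ iter (n * m) φ r) × (∀ r → iter (n * m) φ r ≤ lo + c ^ n)
    iter-spread per φ≤1 zero = 0 , (λ r → z≤n) , φ≤1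
    iter-spread {φ} per φ≤1 (suc n) with iter-spread per φ≤1 n
    ... | lo , lower , upper with iter-contract (iter-periodic per (n * m)) lower upper
    ... | lo′ , lower′ , upper′ = lo′ ,
      (λ r → ≤-trans (lower′ r) (≤-reflexive (sym (iter-+ m (n * m) φ r)))) ,
      (λ r → ≤-trans (≤-reflexive (iter-+ m (n * m) φ r)) (upper′ r))

    -- The m values of iter (n * m) φ over one period add up to 2 ^ (n * m) and lie in an
    -- interval of length c ^ n, so each of them is within c ^ n of their average.
    iter-close : ∀ {φ} → Periodic m φ → (∀ r → φ r ≤ 1) → window φ m 0 ≡ 1 → ∀ n →
      m * iter (n * m) φ 0 ≤ 2 ^ (n * m) + m * c ^ n ×
      2 ^ (n * m) ≤ m * iter (n * m) φ 0 + m * c ^ n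
    iter-close {φ} per φ≤1 total n with iter-spread per φ≤1 n
    ... | lo , lower , upper = above-avg , below-avg
      where
      open ≤-Reasoning
      mean : window (iter (n * m) φ) m 0 ≡ 2 ^ (n * m)
      mean = trans (window-iter per (n * m)) (trans (cong (2 ^ (n * m) *_) total) (*-identityʳ _))
      above-avg : m * iter (n * m) φ 0 ≤ 2 ^ (n * m) + m * c ^ n
      above-avg = begin
        m * iter (n * m) φ 0                       ≤⟨ *-monoʳ-≤ m (upper 0) ⟩
        m * (lo + c ^ n)                           ≡⟨ *-distribˡ-+ m lo (c ^ n) ⟩
        m * lo + m * c ^ n                         ≡⟨ cong (_+ m * c ^ n) (sym (window-const m lo 0)) ⟩
        window (λ _ → lo) m 0 + m * c ^ n          ≤⟨ +-monoˡ-≤ (m * c ^ n) (window-mono lower m 0) ⟩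
        window (iter (n * m) φ) m 0 + m * c ^ n    ≡⟨ cong (_+ m * c ^ n) mean ⟩
        2 ^ (n * m) + m * c ^ n                    ∎
      below-avg : 2 ^ (n * m) ≤ m * iter (n * m) φ 0 + m * c ^ n
      below-avg = begin
        2 ^ (n * m)                                ≡⟨ sym mean ⟩
        window (iter (n * m) φ) m 0                ≤⟨ window-mono upper m 0 ⟩
        window (λ _ → lo + c ^ n) m 0              ≡⟨ window-const m (lo + c ^ n) 0 ⟩
        m * (lo + c ^ n)                           ≡⟨ *-distribˡ-+ m lo (c ^ n) ⟩
        m * lo + m * c ^ n                         ≤⟨ +-monoˡ-≤ (m * c ^ n) (*-monoʳ-≤ m (lower 0)) ⟩
        m * iter (n * m) φ 0 + m * c ^ n           ∎

  -- The indicator function of the multiples of m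

  module _ (p : ℕ) where

    private
      m : ℕ
      m = suc p

      isZero : ℕ → ℕ
      isZero zero    = 1
      isZero (suc _) = 0

    -- Its value is 1 on the multiples of m = suc p and 0 elsewhere.
    multiple : ℕ → ℕ
    multiple r = isZero (r % m)

    multiple-periodic : Periodic m multiple
    multiple-periodic r = cong isZero (trans (cong (_% m) (+-comm m r)) ([m+n]%n≡m%n r m))

    multiple≤1 : ∀ r → multiple r ≤ 1
    multiple≤1 r with r % m
    ... | zero  = ≤-refl
    ... | suc _ = z≤n

    -- A block of m consecutive indices starting at a multiple of m contains just that
    -- multiple.
    ∑-multiple : ∀ k (f : ℕ → ℕ) → ∑ m (λ i → f i * multiple (k * m + i)) ≡ f 0
    ∑-multiple k f = trans (cong₂ _+_
      (trans (cong (λ x → f 0 * isZero x) (residue 0 (s≤s z≤n))) (*-identityʳ (f 0)))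
      (∑-zero p λ i i<p → trans (cong (λ x → f (suc i) * isZero x) (residue (suc i) (s≤s i<p)))
        (*-zeroʳ (f (suc i)))))
      (+-identityʳ (f 0))
      where
      residue : ∀ (i : ℕ) → i < m → (k * m + i) % m ≡ i
      residue i i<m = trans (cong (_% m) (+-comm (k * m) i)) (trans ([m+kn]%n≡m%n i k m) (m<n⇒m%n≡m i<m))

    window-multiple : window multiple m 0 ≡ 1
    window-multiple = trans (window-∑ multiple m 0)
      (trans (∑-cong m λ i _ → sym (*-identityˡ (multiple i))) (∑-multiple 0 (λ _ → 1)))

    -- The binomial coefficients are summed over j < (n + 1) * m, one block of length m
    -- for each k ≤ n.
    iter-multiple : ∀ n → iter (n * m) multiple 0 ≡ ∑ (suc n) (λ k → (n * m) C (k * m))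
    iter-multiple n = begin
      iter (n * m) multiple 0
        ≡⟨ iter-binomial (n * m) (suc n * m) multiple 0 (s≤s (m≤n+m (n * m) p)) ⟩
      ∑ (suc n * m) (λ j → ((n * m) C j) * multiple j)
        ≡⟨ ∑-blocks (suc n) m (λ j → ((n * m) C j) * multiple j) ⟩
      ∑ (suc n) (λ k → ∑ m (λ i → ((n * m) C (k * m + i)) * multiple (k * m + i)))
        ≡⟨ ∑-cong (suc n) (λ k _ → trans (∑-multiple k (λ i → (n * m) C (k * m + i)))
             (cong ((n * m) C_) (+-identityʳ (k * m)))) ⟩
      ∑ (suc n) (λ k → (n * m) C (k * m)) ∎
      where open ≡-Reasoning

  -- The relative error of the binomial sum

  -- Bernoulli's inequality for (1 + m / c) ^ n, without division.  It gives the decay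
  -- of (c / (c + m)) ^ n at rate 1 / n.
  bernoulli : ∀ c m n → n * (m * c ^ n) ≤ c * (c + m) ^ n
  bernoulli c m n = ≤-trans (m≤n+m (n * (m * c ^ n)) (c * c ^ n))
    (≤-trans (≤-reflexive (regroup c m n (c ^ n))) (strong n))
    where
    regroup : ∀ c m n x → c * x + n * (m * x) ≡ (c + n * m) * x
    regroup = solve-∀
    open ≤-Reasoning
    split : ∀ c m k x → c * (c + k) * x + c * m * x + k * m * x ≡ (c + m) * ((c + k) * x)
    split = solve-∀
    join : ∀ c m k x → (c + (m + k)) * (c * x) ≡ c * (c + k) * x + c * m * x
    join = solve-∀
    swap : ∀ a b x → a * (b * x) ≡ b * (a * x)
    swap = solve-∀
    -- c ^ (n - 1) is avoided by multiplying through by c.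
    strong : ∀ n → (c + n * m) * c ^ n ≤ c * (c + m) ^ n
    strong zero    = ≤-reflexive (cong (_* 1) (+-identityʳ c))
    strong (suc n) = begin
      (c + (m + n * m)) * (c * c ^ n)        ≡⟨ join c m (n * m) (c ^ n) ⟩
      c * (c + n * m) * c ^ n + c * m * c ^ n ≤⟨ m≤m+n _ (n * m * m * c ^ n) ⟩
      c * (c + n * m) * c ^ n + c * m * c ^ n + n * m * m * c ^ n ≡⟨ split c m (n * m) (c ^ n) ⟩
      (c + m) * ((c + n * m) * c ^ n)        ≤⟨ *-monoʳ-≤ (c + m) (strong n) ⟩
      (c + m) * (c * (c + m) ^ n)            ≡⟨ swap (c + m) c ((c + m) ^ n) ⟩
      c * ((c + m) * (c + m) ^ n)            ∎

  n<2^n : ∀ n → n < 2 ^ n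
  n<2^n zero    = s≤s z≤n
  n<2^n (suc n) = begin-strict
    suc n            ≤⟨ n<2^n n ⟩
    2 ^ n            <⟨ m<m+n (2 ^ n) (≤-<-trans z≤n (n<2^n n)) ⟩
    2 ^ n + 2 ^ n    ≡⟨ cong (2 ^ n +_) (sym (+-identityʳ (2 ^ n))) ⟩
    2 * 2 ^ n        ∎
    where open ≤-Reasoning

  -- The sum of (m * n) C (m * k) over k ≤ n.
  binomialSum : ℕ → ℕ → ℕ
  binomialSum m n = sum (map (λ k → (m * n) C (m * k)) (upTo (suc n)))

  -- The difference of m * binomialSum m n and 2 ^ (m * n) is at most
  -- 2 ^ (m * n) * 2 ^ m / n.
  binomialSum-close : ∀ m n .{{_ : NonZero m}} →
    n * (m * binomialSum m n) ≤ n * 2 ^ (m * n) + 2 ^ m * 2 ^ (m * n) ×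
    n * 2 ^ (m * n) ≤ n * (m * binomialSum m n) + 2 ^ m * 2 ^ (m * n)
  binomialSum-close m@(suc p) n = scale (proj₁ close) , scale (proj₂ close)
    where
    c S : ℕ
    c = 2 ^ m ∸ m
    S = binomialSum m n
    c+m≡2^m : c + m ≡ 2 ^ m
    c+m≡2^m = m∸n+n≡m (<⇒≤ (n<2^n m))
    S≡ : iter (n * m) (multiple p) 0 ≡ S
    S≡ = trans (iter-multiple p n) (trans
      (∑-cong (suc n) λ k _ → cong₂ _C_ (*-comm n m) (*-comm k m))
      (cong sum (sym (map-upTo (λ k → (m * n) C (m * k)) (suc n)))))
    close : m * S ≤ 2 ^ (m * n) + m * c ^ n × 2 ^ (m * n) ≤ m * S + m * c ^ n
    close = subst₂ (λ s N → m * s ≤ 2 ^ N + m * c ^ n × 2 ^ N ≤ m * s + m * c ^ n) S≡ (*-comm n m)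
      (iter-close m c c+m≡2^m (multiple-periodic p) (multiple≤1 p) (window-multiple p) n)
    error : n * (m * c ^ n) ≤ 2 ^ m * 2 ^ (m * n)
    error = ≤-trans (bernoulli c m n) (*-mono-≤ (m∸n≤m (2 ^ m) m)
      (≤-reflexive (trans (cong (_^ n) c+m≡2^m) (^-*-assoc 2 m n))))
    scale : ∀ {x y} → x ≤ y + m * c ^ n → n * x ≤ n * y + 2 ^ m * 2 ^ (m * n)
    scale {x} {y} le = ≤-trans (*-monoʳ-≤ n le) (≤-trans
      (≤-reflexive (*-distribˡ-+ n y (m * c ^ n))) (+-monoʳ-≤ (n * y) error))

-- The functional equation of the exponential series

module Exponential where

  open import Data.Nat.Base as ℕ using (ℕ; zero; suc)
  import Data.Nat.Properties as ℕ
  open import Data.Rational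
  open import Data.Rational.Properties
  import Data.Rational.Solver as ℚSolver
  open ℚSolver.+-*-Solver using (solve; _:+_; _:*_; _:-_; _:=_; con)

  -- The sum of a i over i ≤ k.
  partial : (ℕ → ℚ) → ℕ → ℚ
  partial a zero    = a 0
  partial a (suc k) = partial a k + a (suc k)

  partial-expTerm : ∀ x k → partial (expTerm x) k ≡ expSum x k
  partial-expTerm x zero    = refl
  partial-expTerm x (suc k) = cong (_+ expTerm x (suc k)) (partial-expTerm x k)

  partial-first : ∀ a k → partial a (suc k) ≡ a 0 + partial (a ∘ suc) k
  partial-first a zero    = refl
  partial-first a (suc k) = trans (cong (_+ a (suc (suc k))) (partial-first a k))
    (+-assoc (a 0) (partial (a ∘ suc) k) (a (suc (suc k))))

  partial-cong : ∀ {a b} → (∀ i → a i ≡ b i) → ∀ k → partial a k ≡ partial b k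
  partial-cong a≗b zero    = a≗b 0
  partial-cong a≗b (suc k) = cong₂ _+_ (partial-cong a≗b k) (a≗b (suc k))

  partial-bound : ∀ {a b} → (∀ i → ∣ a i ∣ ≤ b i) → ∀ k → ∣ partial a k ∣ ≤ partial b k
  partial-bound a≤b zero    = a≤b 0
  partial-bound {a} a≤b (suc k) = ≤-trans (∣p+q∣≤∣p∣+∣q∣ (partial a k) (a (suc k)))
    (+-mono-≤ (partial-bound a≤b k) (a≤b (suc k)))

  -- Convolution and the binomial theorem

  -- The convolution of a and b: the sum of a i * b j over i + j = n.  The recursion
  -- splits off the term i = 0.
  conv : (a b : ℕ → ℚ) → ℕ → ℚ
  conv a b zero    = a 0 * b 0
  conv a b (suc n) = conv (a ∘ suc) b n + a 0 * b (suc n)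

  conv-+ˡ : ∀ a a′ b n → conv (λ i → a i + a′ i) b n ≡ conv a b n + conv a′ b n
  conv-+ˡ a a′ b zero    = *-distribʳ-+ (b 0) (a 0) (a′ 0)
  conv-+ˡ a a′ b (suc n) = trans (cong (_+ (a 0 + a′ 0) * b (suc n)) (conv-+ˡ (a ∘ suc) (a′ ∘ suc) b n))
    (solve 5 (λ u v x y z → (u :+ v) :+ (x :+ y) :* z := (u :+ x :* z) :+ (v :+ y :* z)) refl
      (conv (a ∘ suc) b n) (conv (a′ ∘ suc) b n) (a 0) (a′ 0) (b (suc n)))

  conv-cong : ∀ {a a′ b b′} → (∀ i → a i ≡ a′ i) → (∀ i → b i ≡ b′ i) → ∀ n → conv a b n ≡ conv a′ b′ n
  conv-cong a≗a′ b≗b′ zero    = cong₂ _*_ (a≗a′ 0) (b≗b′ 0)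
  conv-cong a≗a′ b≗b′ (suc n) = cong₂ _+_ (conv-cong (a≗a′ ∘ suc) b≗b′ n) (cong₂ _*_ (a≗a′ 0) (b≗b′ (suc n)))

  conv-scaleˡ : ∀ x a b n → conv (λ i → x * a i) b n ≡ x * conv a b n
  conv-scaleˡ x a b zero    = *-assoc x (a 0) (b 0)
  conv-scaleˡ x a b (suc n) = trans (cong (_+ x * a 0 * b (suc n)) (conv-scaleˡ x (a ∘ suc) b n))
    (solve 4 (λ x u v w → x :* u :+ x :* v :* w := x :* (u :+ v :* w)) refl
      x (conv (a ∘ suc) b n) (a 0) (b (suc n)))

  conv-scaleʳ : ∀ x a b n → conv a (λ i → x * b i) n ≡ x * conv a b n
  conv-scaleʳ x a b zero    = solve 3 (λ x u v → u :* (x :* v) := x :* (u :* v)) refl x (a 0) (b 0)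
  conv-scaleʳ x a b (suc n) = trans (cong (_+ a 0 * (x * b (suc n))) (conv-scaleʳ x (a ∘ suc) b n))
    (solve 4 (λ x u v w → x :* u :+ v :* (x :* w) := x :* (u :+ v :* w)) refl
      x (conv (a ∘ suc) b n) (a 0) (b (suc n)))

  -- The coefficients of the derivative of the power series with coefficients a.
  ∂ : (ℕ → ℚ) → ℕ → ℚ
  ∂ a i = fromℕ (suc i) * a (suc i)

  ∂-shift : ∀ a i → ∂ (a ∘ suc) i + a (suc (suc i)) ≡ ∂ a (suc i)
  ∂-shift a i = trans (solve 2 (λ n u → n :* u :+ u := (con 1ℚ :+ n) :* u) refl (fromℕ (suc i)) (a (suc (suc i))))
    (cong (_* a (suc (suc i))) (sym (fromℕ-suc (suc i))))

  -- The product rule for formal power series.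
  leibniz : ∀ a b n → ∂ (conv a b) n ≡ conv (∂ a) b n + conv a (∂ b) n
  leibniz a b zero    = solve 4 (λ a0 a1 b0 b1 → con 1ℚ :* (a1 :* b0 :+ a0 :* b1)
    := con 1ℚ :* a1 :* b0 :+ a0 :* (con 1ℚ :* b1)) refl (a 0) (a 1) (b 0) (b 1)
  leibniz a b (suc n) = begin
    fromℕ (suc (suc n)) * (C + a 0 * b (suc (suc n)))
      ≡⟨ cong (_* (C + a 0 * b (suc (suc n)))) (fromℕ-suc (suc n)) ⟩
    (1ℚ + fromℕ (suc n)) * (C + a 0 * b (suc (suc n)))
      ≡⟨ solve 4 (λ n c x y → (con 1ℚ :+ n) :* (c :+ x :* y)
           := n :* c :+ c :+ x :* ((con 1ℚ :+ n) :* y)) refl (fromℕ (suc n)) C (a 0) (b (suc (suc n))) ⟩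
    fromℕ (suc n) * C + C + a 0 * ((1ℚ + fromℕ (suc n)) * b (suc (suc n)))
      ≡⟨ cong₂ (λ u v → u + C + a 0 * (v * b (suc (suc n)))) (leibniz a′ b n) (sym (fromℕ-suc (suc n))) ⟩
    (conv (∂ a′) b n + conv a′ (∂ b) n) + (conv (a′ ∘ suc) b n + a 1 * b (suc n)) + a 0 * ∂ b (suc n)
      ≡⟨ solve 6 (λ p q r x y z → (p :+ q) :+ (r :+ x :* y) :+ z
           := ((p :+ r) :+ con 1ℚ :* x :* y) :+ (q :+ z)) refl
           (conv (∂ a′) b n) (conv a′ (∂ b) n) (conv (a′ ∘ suc) b n) (a 1) (b (suc n)) (a 0 * ∂ b (suc n)) ⟩
    ((conv (∂ a′) b n + conv (a′ ∘ suc) b n) + ∂ a 0 * b (suc n)) + conv a (∂ b) (suc n)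
      ≡⟨ cong (λ u → (u + ∂ a 0 * b (suc n)) + conv a (∂ b) (suc n))
           (trans (sym (conv-+ˡ (∂ a′) (a′ ∘ suc) b n)) (conv-cong (∂-shift a) (λ _ → refl) n)) ⟩
    conv (∂ a) b (suc n) + conv a (∂ b) (suc n) ∎
    where
    open ≡-Reasoning
    a′ : ℕ → ℚ
    a′ = a ∘ suc
    C : ℚ
    C = conv a′ b (suc n)

  ∂-expTerm : ∀ x i → ∂ (expTerm x) i ≡ x * expTerm x i
  ∂-expTerm x i = trans
    (solve 4 (λ n t x u → n :* (t :* (x :* u)) := (n :* u) :* (x :* t)) refl
      (fromℕ (suc i)) (expTerm x i) x (unit i))
    (trans (cong (_* (x * expTerm x i)) (fromℕ*unit i)) (*-identityˡ (x * expTerm x i)))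

  ∂-injective : ∀ {a b} n → ∂ a n ≡ ∂ b n → a (suc n) ≡ b (suc n)
  ∂-injective {a} {b} n eq = trans (unscale (a (suc n))) (trans (cong (unit n *_) eq) (sym (unscale (b (suc n)))))
    where
    unscale : ∀ z → z ≡ unit n * (fromℕ (suc n) * z)
    unscale z = trans (sym (*-identityˡ z)) (trans (cong (_* z) (sym (fromℕ*unit n)))
      (solve 3 (λ f u z → (f :* u) :* z := u :* (f :* z)) refl (fromℕ (suc n)) (unit n) z))

  -- The binomial theorem in divided form.  Multiplying by n + 1, i.e. differentiating,
  -- reduces it to the previous degree.
  expTerm-+ : ∀ x y n → expTerm (x + y) n ≡ conv (expTerm x) (expTerm y) n
  expTerm-+ x y zero    = refl
  expTerm-+ x y (suc n) = ∂-injective {expTerm (x + y)} {conv (expTerm x) (expTerm y)} n (begin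
    ∂ (expTerm (x + y)) n                      ≡⟨ ∂-expTerm (x + y) n ⟩
    (x + y) * expTerm (x + y) n                ≡⟨ cong ((x + y) *_) (expTerm-+ x y n) ⟩
    (x + y) * C                                ≡⟨ *-distribʳ-+ C x y ⟩
    x * C + y * C                              ≡⟨ sym (cong₂ _+_
        (trans (conv-cong (∂-expTerm x) (λ _ → refl) n) (conv-scaleˡ x (expTerm x) (expTerm y) n))
        (trans (conv-cong (λ _ → refl) (∂-expTerm y) n) (conv-scaleʳ y (expTerm x) (expTerm y) n))) ⟩
    conv (∂ (expTerm x)) (expTerm y) n + conv (expTerm x) (∂ (expTerm y)) n
                                               ≡⟨ sym (leibniz (expTerm x) (expTerm y) n) ⟩
    ∂ (conv (expTerm x) (expTerm y)) n         ∎)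
    where
    open ≡-Reasoning
    C : ℚ
    C = conv (expTerm x) (expTerm y) n

  -- Products of partial sums

  partial-conv-first : ∀ a b k →
    partial (conv a b) (suc k) ≡ partial (conv (a ∘ suc) b) k + a 0 * partial b (suc k)
  partial-conv-first a b zero    = solve 4 (λ x y u v → x :* u :+ (y :* u :+ x :* v)
    := y :* u :+ x :* (u :+ v)) refl (a 0) (a 1) (b 0) (b 1)
  partial-conv-first a b (suc k) = trans
    (cong (_+ conv a b (suc (suc k))) (partial-conv-first a b k))
    (solve 5 (λ p x q c y → (p :+ x :* q) :+ (c :+ x :* y) := (p :+ c) :+ x :* (q :+ y)) refl
      (partial (conv (a ∘ suc) b) k) (a 0) (partial b (suc k)) (conv (a ∘ suc) b (suc k)) (b (suc (suc k))))

  -- The sum of a i * b j over i, j ≤ k with i + j > k: the terms of the product of two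
  -- partial sums that the partial sum of the convolution lacks; see partial-*.  In the
  -- recursion the terms with j = k + 1 are split off, and the index of a is shifted.
  excess : (a b : ℕ → ℚ) → ℕ → ℚ
  excess a b zero    = 0ℚ
  excess a b (suc k) = excess (a ∘ suc) b k + partial (a ∘ suc) k * b (suc k)

  partial-* : ∀ a b k → partial a k * partial b k ≡ partial (conv a b) k + excess a b k
  partial-* a b zero    = sym (+-identityʳ (a 0 * b 0))
  partial-* a b (suc k) = begin
    partial a (suc k) * (B + b (suc k))
      ≡⟨ cong (_* (B + b (suc k))) (partial-first a k) ⟩
    (a 0 + A′) * (B + b (suc k))
      ≡⟨ solve 4 (λ x p q y → (x :+ p) :* (q :+ y) := (p :* q :+ p :* y) :+ x :* (q :+ y)) refl
           (a 0) A′ B (b (suc k)) ⟩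
    (A′ * B + A′ * b (suc k)) + a 0 * (B + b (suc k))
      ≡⟨ cong (λ z → (z + A′ * b (suc k)) + a 0 * (B + b (suc k))) (partial-* (a ∘ suc) b k) ⟩
    (partial (conv (a ∘ suc) b) k + excess (a ∘ suc) b k + A′ * b (suc k)) + a 0 * (B + b (suc k))
      ≡⟨ solve 4 (λ p e y z → (p :+ e :+ y) :+ z := (p :+ z) :+ (e :+ y)) refl
           (partial (conv (a ∘ suc) b) k) (excess (a ∘ suc) b k) (A′ * b (suc k)) (a 0 * (B + b (suc k))) ⟩
    (partial (conv (a ∘ suc) b) k + a 0 * (B + b (suc k))) + excess a b (suc k)
      ≡⟨ cong (_+ excess a b (suc k)) (sym (partial-conv-first a b k)) ⟩
    partial (conv a b) (suc k) + excess a b (suc k) ∎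
    where
    open ≡-Reasoning
    A′ B : ℚ
    A′ = partial (a ∘ suc) k
    B  = partial b k

  ∣*∣-bound : ∀ {p q r s} → ∣ p ∣ ≤ q → ∣ r ∣ ≤ s → ∣ p * r ∣ ≤ q * s
  ∣*∣-bound {p} {q} {r} {s} p≤q r≤s = subst (_≤ q * s) (sym (∣p*q∣≡∣p∣*∣q∣ p r))
    (*-mono (≤-trans (0≤∣p∣ p) p≤q) (0≤∣p∣ r) p≤q r≤s)

  excess-bound : ∀ {a a′ b b′} → (∀ i → ∣ a i ∣ ≤ a′ i) → (∀ i → ∣ b i ∣ ≤ b′ i) → ∀ k →
    ∣ excess a b k ∣ ≤ excess a′ b′ k
  excess-bound a≤a′ b≤b′ zero = ≤-refl
  excess-bound {a} {b = b} a≤a′ b≤b′ (suc k) = ≤-trans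
    (∣p+q∣≤∣p∣+∣q∣ (excess (a ∘ suc) b k) (partial (a ∘ suc) k * b (suc k)))
    (+-mono-≤ (excess-bound (a≤a′ ∘ suc) b≤b′ k)
      (∣*∣-bound {partial (a ∘ suc) k} {_} {b (suc k)} (partial-bound (a≤a′ ∘ suc) k) (b≤b′ (suc k))))

  partial-nonNeg : ∀ {a} → (∀ i → 0ℚ ≤ a i) → ∀ k → 0ℚ ≤ partial a k
  partial-nonNeg 0≤a zero    = 0≤a 0
  partial-nonNeg 0≤a (suc k) = 0≤+ (partial-nonNeg 0≤a k) (0≤a (suc k))

  -- For nonnegative sequences the square i ≤ j, i′ ≤ k is contained in the triangle
  -- i + i′ ≤ j + k.
  partial-*≤ : ∀ {a b} → (∀ i → 0ℚ ≤ a i) → (∀ i → 0ℚ ≤ b i) → ∀ j k →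
    partial a j * partial b k ≤ partial (conv a b) (j ℕ.+ k)
  partial-*≤             0≤a 0≤b zero zero    = ≤-refl
  partial-*≤ {a} {b} 0≤a 0≤b zero (suc k) = begin
    a 0 * partial b (suc k)                                        ≤⟨ p≤p+q rest≥0 ⟩
    a 0 * partial b (suc k) + partial (conv (a ∘ suc) b) k         ≡⟨ +-comm (a 0 * partial b (suc k)) _ ⟩
    partial (conv (a ∘ suc) b) k + a 0 * partial b (suc k)         ≡⟨ sym (partial-conv-first a b k) ⟩
    partial (conv a b) (suc k)                                     ∎
    where
    open ≤-Reasoning
    conv-nonNeg : ∀ {a} → (∀ i → 0ℚ ≤ a i) → ∀ n → 0ℚ ≤ conv a b n
    conv-nonNeg 0≤a zero    = 0≤* (0≤a 0) (0≤b 0)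
    conv-nonNeg 0≤a (suc n) = 0≤+ (conv-nonNeg (0≤a ∘ suc) n) (0≤* (0≤a 0) (0≤b (suc n)))
    rest≥0 : 0ℚ ≤ partial (conv (a ∘ suc) b) k
    rest≥0 = partial-nonNeg (conv-nonNeg (0≤a ∘ suc)) k
  partial-*≤ {a} {b} 0≤a 0≤b (suc j) k = begin
    partial a (suc j) * B                                          ≡⟨ cong (_* B) (partial-first a j) ⟩
    (a 0 + partial (a ∘ suc) j) * B                                ≡⟨ solve 3 (λ x p q →
        (x :+ p) :* q := p :* q :+ x :* q) refl (a 0) (partial (a ∘ suc) j) B ⟩
    partial (a ∘ suc) j * B + a 0 * B                              ≤⟨ +-mono-≤
        (partial-*≤ (0≤a ∘ suc) 0≤b j k) (*-monoˡ (0≤a 0) (grow (suc j))) ⟩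
    partial (conv (a ∘ suc) b) (j ℕ.+ k) + a 0 * partial b (suc (j ℕ.+ k)) ≡⟨ sym (partial-conv-first a b (j ℕ.+ k)) ⟩
    partial (conv a b) (suc (j ℕ.+ k))                             ∎
    where
    open ≤-Reasoning
    B : ℚ
    B = partial b k
    grow : ∀ j → B ≤ partial b (j ℕ.+ k)
    grow zero    = ≤-refl
    grow (suc j) = ≤-trans (grow j) (p≤p+q (0≤b (suc (j ℕ.+ k))))

  partial-expTerm-+ : ∀ x y k → partial (conv (expTerm x) (expTerm y)) k ≡ expSum (x + y) k
  partial-expTerm-+ x y k = trans (partial-cong (λ n → sym (expTerm-+ x y n)) k) (partial-expTerm (x + y) k)

  expSum-* : ∀ x y k → expSum x k * expSum y k ≡ expSum (x + y) k + excess (expTerm x) (expTerm y) k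
  expSum-* x y k = trans
    (cong₂ _*_ (sym (partial-expTerm x k)) (sym (partial-expTerm y k)))
    (trans (partial-* (expTerm x) (expTerm y) k)
      (cong (_+ excess (expTerm x) (expTerm y) k) (partial-expTerm-+ x y k)))

  -- The excess for x and y is at most that for c and c, and the latter is at most the
  -- part of the exponential series of c + c between the degrees k and 2k.
  expSum-+-close : ∀ {x y c} → ∣ x ∣ ≤ c → ∣ y ∣ ≤ c → ∀ k →
    ∣ expSum (x + y) k - expSum x k * expSum y k ∣ ≤ expSum (c + c) (k ℕ.+ k) - expSum (c + c) k
  expSum-+-close {x} {y} {c} x≤c y≤c k = begin
    ∣ expSum (x + y) k - expSum x k * expSum y k ∣
      ≡⟨ cong (λ z → ∣ expSum (x + y) k - z ∣) (expSum-* x y k) ⟩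
    ∣ expSum (x + y) k - (expSum (x + y) k + e) ∣
      ≡⟨ trans (∣-∣-comm (expSum (x + y) k) (expSum (x + y) k + e)) (cong ∣_∣ (cancel (expSum (x + y) k) e)) ⟩
    ∣ e ∣
      ≤⟨ excess-bound (expTerm-bound x≤c) (expTerm-bound y≤c) k ⟩
    E
      ≡⟨ sym (cancel (expSum (c + c) k) E) ⟩
    (expSum (c + c) k + E) - expSum (c + c) k
      ≤⟨ +-monoˡ-≤ (- expSum (c + c) k) (subst₂ _≤_ product (partial-expTerm-+ c c (k ℕ.+ k))
           (partial-*≤ 0≤t 0≤t k k)) ⟩
    expSum (c + c) (k ℕ.+ k) - expSum (c + c) k ∎
    where
    open ≤-Reasoning
    e E : ℚ
    e = excess (expTerm x) (expTerm y) k
    E = excess (expTerm c) (expTerm c) k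
    0≤t : ∀ i → 0ℚ ≤ expTerm c i
    0≤t = expTerm-nonNeg (≤-trans (0≤∣p∣ x) x≤c)
    cancel : ∀ p q → (p + q) - p ≡ q
    cancel = solve 2 (λ p q → (p :+ q) :- p := q) refl
    product : partial (expTerm c) k * partial (expTerm c) k ≡ expSum (c + c) k + E
    product = trans (partial-* (expTerm c) (expTerm c) k) (cong (_+ E) (partial-expTerm-+ c c k))

  -- The functional equation exp (x + y) = exp x * exp y for bounded approximations.
  exp-+ : ∀ (x y : ℕ → ℚ) b → (∀ k → ∣ x k ∣ ≤ fromℕ b) → (∀ k → ∣ y k ∣ ≤ fromℕ b) →
    Small (λ k _ → ∣ expSum (x k + y k) k - expSum (x k) k * expSum (y k) k ∣)
  exp-+ x y b x≤b y≤b ε 0<ε with Tail.S-cauchy (b ℕ.+ b) ε 0<ε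
  ... | N , close = N , λ k _ h _ → ≤-<-trans (expSum-+-close (x≤b k) (y≤b k) k)
    (≤-<-trans (p≤∣p∣ (expSum (β + β) (k ℕ.+ k) - expSum (β + β) k))
      (subst (λ c → ∣ expSum c (k ℕ.+ k) - expSum c k ∣ < ε) (Tail.fromℕ-+ b b b)
        (close (k ℕ.+ k) k (ℕ.≤-trans h (ℕ.m≤m+n k k)) h)))
    where
    β : ℚ
    β = fromℕ b

-- The logarithm of 2

module Logarithm where

  open import Data.Integer.Base using (+_)
  open import Data.Nat.Base as ℕ using (ℕ; zero; suc)
  import Data.Nat.Properties as ℕ
  open Exponential
  open import Data.Rational
  open import Data.Rational.Properties
  import Data.Rational.Unnormalised as ℚᵘ
  import Data.Rational.Unnormalised.Properties as ℚᵘ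
  import Data.Integer.Base as ℤ
  import Data.Integer.Properties as ℤ
  import Data.Rational.Solver as ℚSolver
  open ℚSolver.+-*-Solver using (solve; _:+_; _:*_; _:-_; :-_; _:=_; con)

  fromℕ-+ : ∀ m n → fromℕ (m ℕ.+ n) ≡ fromℕ m + fromℕ n
  fromℕ-+ = Tail.fromℕ-+ 0

  fromℕ-* : ∀ m n → fromℕ (m ℕ.* n) ≡ fromℕ m * fromℕ n
  fromℕ-* zero    n = sym (*-zeroˡ (fromℕ n))
  fromℕ-* (suc m) n = begin
    fromℕ (n ℕ.+ m ℕ.* n)            ≡⟨ fromℕ-+ n (m ℕ.* n) ⟩
    fromℕ n + fromℕ (m ℕ.* n)        ≡⟨ cong (λ z → fromℕ n + z) (fromℕ-* m n) ⟩
    fromℕ n + fromℕ m * fromℕ n      ≡⟨ solve 2 (λ m n → n :+ m :* n := (con 1ℚ :+ m) :* n) refl (fromℕ m) (fromℕ n) ⟩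
    (1ℚ + fromℕ m) * fromℕ n         ≡⟨ cong (_* fromℕ n) (sym (fromℕ-suc m)) ⟩
    fromℕ (suc m) * fromℕ n          ∎
    where open ≡-Reasoning

  /≡fromℕ*unit : ∀ a i → + a / suc i ≡ fromℕ a * unit i
  /≡fromℕ*unit a i = toℚᵘ-injective (begin
    toℚᵘ (+ a / suc i)                       ≈⟨ toℚᵘ-fromℚᵘ (ℚᵘ.mkℚᵘ (+ a) i) ⟩
    ℚᵘ.mkℚᵘ (+ a) i                          ≈⟨ ℚᵘ.*≡* (cong₂ ℤ._*_ (sym (ℤ.*-identityʳ (+ a))) (cong +_ (ℕ.*-identityˡ (suc i)))) ⟩
    ℚᵘ.mkℚᵘ (+ a) 0 ℚᵘ.* ℚᵘ.mkℚᵘ (+ 1) i     ≈⟨ ℚᵘ.≃-sym (ℚᵘ.*-cong (toℚᵘ-fromℚᵘ (ℚᵘ.mkℚᵘ (+ a) 0)) (toℚᵘ-fromℚᵘ (ℚᵘ.mkℚᵘ (+ 1) i))) ⟩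
    toℚᵘ (fromℕ a) ℚᵘ.* toℚᵘ (unit i)        ≈⟨ ℚᵘ.≃-sym (toℚᵘ-homo-* (fromℕ a) (unit i)) ⟩
    toℚᵘ (fromℕ a * unit i)                  ∎)
    where open ℚᵘ.≃-Reasoning

  -- The archimedean property, in the form used for limits.
  eventually-large : ∀ {c ε} → 0ℚ < ε → ∃[ N ] (∀ n → N ℕ.≤ n → c ≤ fromℕ n * ε)
  eventually-large {c} {ε} 0<ε with archimedean (c * (1/ ε) {{>-nonZero 0<ε}})
  ... | N , le = N , λ n N≤n → subst (_≤ fromℕ n * ε)
    (trans (*-assoc c _ ε) (trans (cong (c *_) (*-inverseˡ ε {{>-nonZero 0<ε}})) (*-identityʳ c)))
    (*-monoʳ (<⇒≤ 0<ε) (≤-trans le (fromℕ-mono N≤n)))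

  small-unit : Small (λ k _ → unit (ℕ.pred k))
  small-unit ε 0<ε with eventually-large {1ℚ} 0<ε
  ... | N , large = suc N , λ { (suc i) j (ℕ.s≤s N≤i) _ →
    *-cancelˡ-<-nonNeg (fromℕ (suc i)) {{nonNegative (0≤fromℕ (suc i))}} (begin-strict
      fromℕ (suc i) * unit i     ≡⟨ fromℕ*unit i ⟩
      1ℚ                         ≤⟨ large i N≤i ⟩
      fromℕ i * ε                ≡⟨ sym (+-identityˡ (fromℕ i * ε)) ⟩
      0ℚ + fromℕ i * ε           <⟨ +-monoˡ-< (fromℕ i * ε) 0<ε ⟩
      ε + fromℕ i * ε            ≡⟨ solve 2 (λ n e → e :+ n :* e := (con 1ℚ :+ n) :* e) refl (fromℕ i) ε ⟩
      (1ℚ + fromℕ i) * ε         ≡⟨ cong (_* ε) (sym (fromℕ-suc i)) ⟩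
      fromℕ (suc i) * ε          ∎) }
    where open ≤-Reasoning

  small-zero : ∀ {D} → (∀ i j → D i j ≡ 0ℚ) → Small D
  small-zero D≗0 ε 0<ε = 0 , λ i j _ _ → subst (_< ε) (sym (D≗0 i j)) 0<ε

  -- A sequence that starts below c and ends above c crosses c between two consecutive
  -- indices.
  discrete-ivt : ∀ (f : ℕ → ℚ) c n → f 0 ≤ c → c ≤ f (suc n) →
    ∃[ j ] j ℕ.≤ n × f j ≤ c × c ≤ f (suc j)
  discrete-ivt f c zero    lo hi = 0 , ℕ.z≤n , lo , hi
  discrete-ivt f c (suc n) lo hi with ≤-total c (f (suc n))
  ... | inj₂ le = suc n , ℕ.≤-refl , le , hi
  ... | inj₁ ge with discrete-ivt f c n lo ge
  ...   | j , j≤n , below , above = j , ℕ.m≤n⇒m≤1+n j≤n , below , above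

  expSum-0 : ∀ k → expSum 0ℚ k ≡ 1ℚ
  expSum-0 zero    = refl
  expSum-0 (suc k) = trans (cong₂ _+_ (expSum-0 k)
      (trans (cong (expTerm 0ℚ k *_) (*-zeroˡ (unit k))) (*-zeroʳ (expTerm 0ℚ k))))
    (+-identityʳ 1ℚ)

  -- y - x ≤ E y - E x for 0 ≤ x ≤ y, where E is a partial sum of the exponential
  -- series of degree at least 1: the terms of degree 1 contribute y - x, and all others
  -- are monotone.
  expSum-expand : ∀ {x y} → 0ℚ ≤ x → x ≤ y → ∀ k → y + expSum x (suc k) ≤ x + expSum y (suc k)
  expSum-expand {x} {y} 0≤x x≤y zero = ≤-reflexive (solve 2 (λ x y →
    y :+ (con 1ℚ :+ con 1ℚ :* (x :* con 1ℚ)) := x :+ (con 1ℚ :+ con 1ℚ :* (y :* con 1ℚ))) refl x y)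
  expSum-expand {x} {y} 0≤x x≤y (suc k) = begin
    y + (expSum x (suc k) + s)    ≡⟨ sym (+-assoc y (expSum x (suc k)) s) ⟩
    y + expSum x (suc k) + s      ≤⟨ +-mono-≤ (expSum-expand 0≤x x≤y k)
                                       (≤-trans (p≤∣p∣ s) (expTerm-bound (subst (_≤ y) (sym (0≤p⇒∣p∣≡p 0≤x)) x≤y) (suc (suc k)))) ⟩
    x + expSum y (suc k) + t      ≡⟨ +-assoc x (expSum y (suc k)) t ⟩
    x + (expSum y (suc k) + t)    ∎
    where
    open ≤-Reasoning
    s t : ℚ
    s = expTerm x (suc (suc k))
    t = expTerm y (suc (suc k))

  expSum-expanding : ∀ {x y} → 0ℚ ≤ x → 0ℚ ≤ y → ∀ k →
    ∣ x - y ∣ ≤ ∣ expSum x (suc k) - expSum y (suc k) ∣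
  expSum-expanding {x} {y} 0≤x 0≤y k = ordered (≤-total y x)
    where
    E : ℚ → ℚ
    E z = expSum z (suc k)
    gap : ∀ {x y} → 0ℚ ≤ y → y ≤ x → ∣ x - y ∣ ≤ ∣ E x - E y ∣
    gap {x} {y} 0≤y y≤x = begin
      ∣ x - y ∣                    ≡⟨ 0≤p⇒∣p∣≡p (subst (_≤ x - y) (+-inverseʳ y) (+-monoˡ-≤ (- y) y≤x)) ⟩
      x - y                        ≤⟨ p≤q+r⇒p-q≤r {x} {y} (subst₂ _≤_
          (solve 2 (λ x e → (x :+ e) :- e := x) refl x (E y))
          (+-assoc y (E x) (- E y)) (+-monoˡ-≤ (- E y) (expSum-expand 0≤y y≤x k))) ⟩
      E x - E y                    ≤⟨ p≤∣p∣ (E x - E y) ⟩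
      ∣ E x - E y ∣                ∎
      where open ≤-Reasoning
    ordered : y ≤ x ⊎ x ≤ y → ∣ x - y ∣ ≤ ∣ E x - E y ∣
    ordered (inj₁ y≤x) = gap 0≤y y≤x
    ordered (inj₂ x≤y) = subst₂ _≤_ (∣-∣-comm y x) (∣-∣-comm (E y) (E x)) (gap 0≤x x≤y)

  two : ℚ
  two = fromℕ 2

  -- Rational approximations of log 2

  -- An approximation of log 2 from below on the grid of multiples of unit i = 1 / (i + 1)
  -- in [0, 1]: the partial sum of degree i + 1 of the exponential series passes the
  -- value 2 between point and the next grid point.
  record Log2Approx (i : ℕ) : Set where
    field
      point       : ℚ
      0≤point     : 0ℚ ≤ point
      next≤1      : point + unit i ≤ 1ℚ
      expSum≤two  : expSum point (suc i) ≤ two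
      two≤next    : two ≤ expSum (point + unit i) (suc i)

  log2-approx : ∀ i → Log2Approx i
  log2-approx i with discrete-ivt (λ j → expSum (fromℕ j * unit i) (suc i)) two i start end
    where
    start : expSum (fromℕ 0 * unit i) (suc i) ≤ two
    start = subst (_≤ two) (sym (trans (cong (λ z → expSum z (suc i)) (*-zeroˡ (unit i))) (expSum-0 (suc i))))
      (fromℕ-mono {1} {2} (ℕ.s≤s ℕ.z≤n))
    end : two ≤ expSum (fromℕ (suc i) * unit i) (suc i)
    end = subst₂ _≤_ (cong (λ z → 1ℚ + z) (expSum-0 (suc i)))
      (trans (+-identityˡ (expSum 1ℚ (suc i))) (cong (λ z → expSum z (suc i)) (sym (fromℕ*unit i))))
      (expSum-expand {0ℚ} {1ℚ} ≤-refl (0≤fromℕ 1) i)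
  ... | j , j≤i , below , above = record
    { point      = fromℕ j * unit i
    ; 0≤point    = 0≤* (0≤fromℕ j) (0≤unit i)
    ; next≤1     = subst₂ _≤_ next (fromℕ*unit i) (*-monoʳ (0≤unit i) (fromℕ-mono (ℕ.s≤s j≤i)))
    ; expSum≤two = below
    ; two≤next   = subst (λ z → two ≤ expSum z (suc i)) next above
    }
    where
    next : fromℕ (suc j) * unit i ≡ fromℕ j * unit i + unit i
    next = trans (cong (_* unit i) (fromℕ-suc j))
      (solve 2 (λ j u → (con 1ℚ :+ j) :* u := j :* u :+ u) refl (fromℕ j) (unit i))

  -- The approximant with index i + 1 is paired with the partial sum of degree i + 1, as
  -- in the definition of exp.  The value at 0 is arbitrary.
  log2-seq : ℕ → ℚ
  log2-seq zero    = 0ℚ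
  log2-seq (suc i) = Log2Approx.point (log2-approx i)

  0≤log2-seq : ∀ k → 0ℚ ≤ log2-seq k
  0≤log2-seq zero    = ≤-refl
  0≤log2-seq (suc i) = Log2Approx.0≤point (log2-approx i)

  ∣log2-seq∣≤1 : ∀ k → ∣ log2-seq k ∣ ≤ fromℕ 1
  ∣log2-seq∣≤1 zero    = 0≤fromℕ 1
  ∣log2-seq∣≤1 (suc i) = subst (_≤ 1ℚ) (sym (0≤p⇒∣p∣≡p 0≤point)) (≤-trans (p≤p+q (0≤unit i)) next≤1)
    where open Log2Approx (log2-approx i)

  exp-log2-bounded : ∀ k → ∣ expSum (log2-seq k) k ∣ ≤ two
  exp-log2-bounded zero    = fromℕ-mono {1} {2} (ℕ.s≤s ℕ.z≤n)
  exp-log2-bounded (suc i) = subst (_≤ two) (sym (0≤p⇒∣p∣≡p 0≤exp)) expSum≤two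
    where
    open Log2Approx (log2-approx i)
    0≤exp : 0ℚ ≤ expSum point (suc i)
    0≤exp = subst (0ℚ ≤_) (partial-expTerm point (suc i)) (partial-nonNeg (expTerm-nonNeg 0≤point) (suc i))

  -- The value 2 lies between the partial sums at two points at distance unit i, and
  -- the partial sums are Lipschitz on [0, 1] with a constant independent of the degree.
  exp-log2-close : Small (λ k _ → ∣ expSum (log2-seq k) k - two ∣)
  exp-log2-close = small-≤ 2 close (small-* {λ k _ → unit (ℕ.pred k)} B small-unit (λ k _ → 0≤unit (ℕ.pred k)))
    where
    open Tail 1
    B : ℚ
    B = expSum β K + t K
    close : ∀ k j → 2 ℕ.≤ k → 2 ℕ.≤ j → ∣ expSum (log2-seq k) k - two ∣ ≤ B * unit (ℕ.pred k)
    close k@(suc i) j 2≤k _ = begin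
      ∣ expSum point k - two ∣
        ≡⟨ trans (∣-∣-comm (expSum point k) two) (0≤p⇒∣p∣≡p
             (subst (_≤ two - expSum point k) (+-inverseʳ (expSum point k)) (+-monoˡ-≤ (- expSum point k) expSum≤two))) ⟩
      two - expSum point k
        ≤⟨ +-monoˡ-≤ (- expSum point k) two≤next ⟩
      expSum (point + unit i) k - expSum point k
        ≤⟨ p≤∣p∣ (expSum (point + unit i) k - expSum point k) ⟩
      ∣ expSum (point + unit i) k - expSum point k ∣
        ≤⟨ expSum-lipschitz {point + unit i} {point} {β}
             (subst (_≤ β) (sym (0≤p⇒∣p∣≡p (0≤+ 0≤point (0≤unit i)))) next≤1) (∣log2-seq∣≤1 k) k ⟩
      expSum β k * ∣ (point + unit i) - point ∣
        ≡⟨ cong (expSum β k *_) (trans (cong ∣_∣ (solve 2 (λ p u → (p :+ u) :- p := u) refl point (unit i)))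
             (0≤p⇒∣p∣≡p (0≤unit i))) ⟩
      expSum β k * unit i
        ≤⟨ *-monoʳ (0≤unit i) (S-bounded k 2≤k) ⟩
      B * unit i ∎
      where
      open ≤-Reasoning
      open Log2Approx (log2-approx i)

  -- Partial sums of degree at least 1 do not decrease distances, so the approximants
  -- are as close as the values of a common partial sum, both of which are close to 2.
  log2-cauchy : Cauchy log2-seq
  log2-cauchy = small-≤ 1 close
    (small-+ {λ i j → e i + e j} {λ i j → ∣ expSum β j - expSum β i ∣}
      (small-+ {λ i _ → e i} {λ _ j → e j} exp-log2-close (small-flip exp-log2-close))
      (small-flip S-cauchy))
    where
    open Tail 1
    e : ℕ → ℚ
    e k = ∣ expSum (log2-seq k) k - two ∣
    small-flip : ∀ {D} → Small D → Small (λ i j → D j i)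
    small-flip sD ε 0<ε = proj₁ (sD ε 0<ε) , λ i j h h′ → proj₂ (sD ε 0<ε) j i h′ h
    close : ∀ i j → 1 ℕ.≤ i → 1 ℕ.≤ j →
      ∣ log2-seq i - log2-seq j ∣ ≤ e i + e j + ∣ expSum β j - expSum β i ∣
    close i@(suc i′) j _ _ = begin
      ∣ x - y ∣                                       ≤⟨ expSum-expanding (0≤log2-seq i) (0≤log2-seq j) i′ ⟩
      ∣ expSum x i - expSum y i ∣                     ≤⟨ ∣-∣-triangle (expSum x i) (expSum y j) (expSum y i) ⟩
      ∣ expSum x i - expSum y j ∣ + ∣ expSum y j - expSum y i ∣
        ≤⟨ +-mono-≤ (subst (λ z → ∣ expSum x i - expSum y j ∣ ≤ e i + z) (∣-∣-comm two (expSum y j))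
                      (∣-∣-triangle (expSum x i) two (expSum y j)))
                    (expSum-tail (∣log2-seq∣≤1 j) j i) ⟩
      e i + e j + ∣ expSum β j - expSum β i ∣         ∎
      where
      open ≤-Reasoning
      x y : ℚ
      x = log2-seq i
      y = log2-seq j

  log2 : ℝ
  log2 = mkℝ log2-seq log2-cauchy

  small⇒≃ : ∀ {x y} → Small (λ k _ → ∣ seq x k - seq y k ∣) → x ≃ᴿ y
  small⇒≃ s ε 0<ε = proj₁ (s ε 0<ε) , λ k h → proj₂ (s ε 0<ε) k k h h

  exp-log2 : IsLog (fromℚ two) log2
  exp-log2 = small⇒≃ {exp log2} {fromℚ two} exp-log2-close

  -- exp (N * log 2) = 2 ^ N, by induction on N.
  exp-log2-power : ∀ N → Small (λ k _ → ∣ expSum (fromℕ N * log2-seq k) k - fromℕ (2 ℕ.^ N) ∣)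
  exp-log2-power zero = small-zero λ k _ → cong (λ z → ∣ z - 1ℚ ∣)
    (trans (cong (λ z → expSum z k) (*-zeroˡ (log2-seq k))) (expSum-0 k))
  exp-log2-power (suc N) = small-≤ 0 close (small-+ {D₁} {λ k j → D₂ k j + D₃ k j} s₁
    (small-+ {D₂} {D₃} (small-* two (exp-log2-power N) (λ k _ → 0≤∣p∣ (Y k - F)))
      (small-* F exp-log2-close (λ k _ → 0≤∣p∣ (X k - two)))))
    where
    ℓ : ℕ → ℚ
    ℓ = log2-seq
    F : ℚ
    F = fromℕ (2 ℕ.^ N)
    X Y : ℕ → ℚ
    X k = expSum (ℓ k) k
    Y k = expSum (fromℕ N * ℓ k) k
    D₁ D₂ D₃ : ℕ → ℕ → ℚ
    D₁ k _ = ∣ expSum (ℓ k + fromℕ N * ℓ k) k - X k * Y k ∣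
    D₂ k _ = two * ∣ Y k - F ∣
    D₃ k _ = F * ∣ X k - two ∣
    s₁ : Small D₁
    s₁ = exp-+ ℓ (λ k → fromℕ N * ℓ k) (suc N)
      (λ k → ≤-trans (∣log2-seq∣≤1 k) (fromℕ-mono {1} {suc N} (ℕ.s≤s ℕ.z≤n)))
      (λ k → ≤-trans (∣*∣-bound {fromℕ N} {fromℕ N} {ℓ k} {1ℚ} (≤-reflexive (0≤p⇒∣p∣≡p (0≤fromℕ N))) (∣log2-seq∣≤1 k))
        (≤-trans (≤-reflexive (*-identityʳ (fromℕ N))) (fromℕ-mono (ℕ.n≤1+n N))))
    arg : ∀ k → fromℕ (suc N) * ℓ k ≡ ℓ k + fromℕ N * ℓ k
    arg k = trans (cong (_* ℓ k) (fromℕ-suc N))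
      (solve 2 (λ n l → (con 1ℚ :+ n) :* l := l :+ n :* l) refl (fromℕ N) (ℓ k))
    close : ∀ k j → 0 ℕ.≤ k → 0 ℕ.≤ j →
      ∣ expSum (fromℕ (suc N) * ℓ k) k - fromℕ (2 ℕ.^ suc N) ∣ ≤ D₁ k j + (D₂ k j + D₃ k j)
    close k j _ _ = begin
      ∣ expSum (fromℕ (suc N) * ℓ k) k - fromℕ (2 ℕ.^ suc N) ∣
        ≡⟨ cong₂ (λ u v → ∣ expSum u k - v ∣) (arg k) (fromℕ-* 2 (2 ℕ.^ N)) ⟩
      ∣ expSum (ℓ k + fromℕ N * ℓ k) k - two * F ∣
        ≤⟨ ∣-∣-triangle (expSum (ℓ k + fromℕ N * ℓ k) k) (X k * Y k) (two * F) ⟩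
      D₁ k j + ∣ X k * Y k - two * F ∣
        ≤⟨ +-monoʳ-≤ (D₁ k j) (*-close {X k} {two} {Y k} {F} (exp-log2-bounded k)
             (≤-reflexive (0≤p⇒∣p∣≡p (0≤fromℕ (2 ℕ.^ N))))) ⟩
      D₁ k j + (D₂ k j + D₃ k j) ∎
      where open ≤-Reasoning

  scaled-exp-log2 : ∀ i N → fromℚ (unit i) *ᴿ exp (fromℚ (fromℕ N) *ᴿ log2) ≃ᴿ fromℚ (+ (2 ℕ.^ N) / suc i)
  scaled-exp-log2 i N = small⇒≃ {fromℚ (unit i) *ᴿ exp (fromℚ (fromℕ N) *ᴿ log2)} {fromℚ (+ (2 ℕ.^ N) / suc i)}
    (small-≤ 0 (λ k _ _ _ → ≤-reflexive (close k))
      (small-* (unit i) (exp-log2-power N) (λ k _ → 0≤∣p∣ (Y k - F))))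
    where
    F : ℚ
    F = fromℕ (2 ℕ.^ N)
    Y : ℕ → ℚ
    Y k = expSum (fromℕ N * log2-seq k) k
    close : ∀ k → ∣ unit i * Y k - + (2 ℕ.^ N) / suc i ∣ ≡ unit i * ∣ Y k - F ∣
    close k = begin
      ∣ unit i * Y k - + (2 ℕ.^ N) / suc i ∣  ≡⟨ cong (λ z → ∣ unit i * Y k - z ∣) (/≡fromℕ*unit (2 ℕ.^ N) i) ⟩
      ∣ unit i * Y k - F * unit i ∣           ≡⟨ cong ∣_∣ (solve 3 (λ u y f →
          u :* y :- f :* u := u :* (y :- f)) refl (unit i) (Y k) F) ⟩
      ∣ unit i * (Y k - F) ∣                  ≡⟨ ∣p*q∣≡∣p∣*∣q∣ (unit i) (Y k - F) ⟩
      ∣ unit i ∣ * ∣ Y k - F ∣                ≡⟨ cong (_* ∣ Y k - F ∣) (0≤p⇒∣p∣≡p (0≤unit i)) ⟩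
      unit i * ∣ Y k - F ∣                    ∎
      where open ≡-Reasoning

  -- Quotients close to 1

  -- If y = q > 0 and p differs from q by at most q * ε / 8, then p / y differs from 1 by
  -- less than ε.  Eventually the approximants g of y are at least q / 2 and differ from q
  -- by at most q * ε / 8; then |p / g - 1| = |p - g| / g is at most (2 / q) * (q * ε / 4).
  -- The other half of ε makes the inequality strict.
  div-close : ∀ {p q ε} (y : ℝ) → 0ℚ < q → 0ℚ < ε → y ≃ᴿ fromℚ q →
    ∣ p - q ∣ ≤ ½ * (½ * ½ * ε) * q →
    Σ (y # 0ᴿ) λ y#0 → ∣ divᴿ (fromℚ p) y y#0 -ᴿ 1ᴿ ∣ᴿ <ᴿ fromℚ ε
  div-close {p} {q} {ε} y 0<q 0<ε y≃q p≈q = inj₂ (δ , 0<δ , N₁ , away) , ½ * ε , 0<½ε , N₁ ℕ.⊔ N₂ , close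
    where
    δ η : ℚ
    δ = ½ * q
    η = ½ * (½ * ½ * ε) * q
    0<½ : 0ℚ < ½
    0<½ = positive⁻¹ ½
    0<δ : 0ℚ < δ
    0<δ = 0<* 0<½ 0<q
    0<½ε : 0ℚ < ½ * ε
    0<½ε = 0<* 0<½ 0<ε
    0<η : 0ℚ < η
    0<η = 0<* (0<* 0<½ (0<* (0<* 0<½ 0<½) 0<ε)) 0<q
    N₁ N₂ : ℕ
    N₁ = proj₁ (y≃q δ 0<δ)
    N₂ = proj₁ (y≃q η 0<η)
    δ≤y : ∀ k → N₁ ℕ.≤ k → δ ≤ seq y k
    δ≤y k h = subst₂ _≤_ (solve 1 (λ q → q :- con ½ :* q := con ½ :* q) refl q)
        (solve 2 (λ q y → q :- (q :- y) := y) refl q (seq y k))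
        (+-monoʳ-≤ q (neg-antimono-≤ (≤-trans (p≤∣p∣ (q - seq y k))
          (≤-trans (≤-reflexive (∣-∣-comm q (seq y k))) (<⇒≤ (proj₂ (y≃q δ 0<δ) k h))))))
    away : ∀ k → N₁ ℕ.≤ k → 0ℚ + δ ≤ seq y k
    away k h = subst (_≤ seq y k) (sym (+-identityˡ δ)) (δ≤y k h)
    close : ∀ k → N₁ ℕ.⊔ N₂ ℕ.≤ k → ∣ p * recip (seq y k) - 1ℚ ∣ + ½ * ε ≤ ε
    close k h = subst (∣ p * r - 1ℚ ∣ + ½ * ε ≤_) (½*½ ε) (+-monoˡ-≤ (½ * ε) (begin
      ∣ p * r - 1ℚ ∣             ≡⟨ cong (λ z → ∣ p * r - z ∣) (sym (recip-inverse g≢0)) ⟩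
      ∣ p * r - g * r ∣          ≡⟨ cong ∣_∣ (solve 3 (λ p g r → p :* r :- g :* r := r :* (p :- g)) refl p g r) ⟩
      ∣ r * (p - g) ∣            ≤⟨ ∣*∣-bound {r} {d} {p - g} {η + η} (∣recip∣≤ 0<δ (≤-trans (δ≤y k h₁) (p≤∣p∣ g)))
          (≤-trans (∣-∣-triangle p q g) (+-mono-≤ p≈q
            (≤-trans (≤-reflexive (∣-∣-comm q g)) (<⇒≤ (proj₂ (y≃q η 0<η) k (ℕ.m⊔n≤o⇒n≤o N₁ N₂ h)))))) ⟩
      d * (η + η)                ≡⟨ solve 3 (λ d q ε →
          d :* (con ½ :* (con ½ :* con ½ :* ε) :* q :+ con ½ :* (con ½ :* con ½ :* ε) :* q)
            := (d :* (con ½ :* q)) :* (con ½ :* ε)) refl d q ε ⟩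
      (d * δ) * (½ * ε)          ≡⟨ cong (_* (½ * ε)) (*-inverseˡ δ {{>-nonZero 0<δ}}) ⟩
      1ℚ * (½ * ε)               ≡⟨ *-identityˡ (½ * ε) ⟩
      ½ * ε                      ∎))
      where
      open ≤-Reasoning
      g r d : ℚ
      g = seq y k
      r = recip g
      d = (1/ δ) {{>-nonZero 0<δ}}
      h₁ : N₁ ℕ.≤ k
      h₁ = ℕ.m⊔n≤o⇒m≤o N₁ N₂ h
      g≢0 : g ≢ 0ℚ
      g≢0 g≡0 = <-irrefl refl (<-≤-trans 0<δ (subst (δ ≤_) g≡0 (δ≤y k h₁)))

  -- The integer inequalities upper and lower say that the difference of (i + 1) * s and f
  -- is at most f * c / (n + 1); dividing by i + 1 bounds that of s and f / (i + 1).
  relative-error : ∀ {s f c η} i n → fromℕ c ≤ fromℕ (suc n) * η →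
    suc n ℕ.* (suc i ℕ.* s) ℕ.≤ suc n ℕ.* f ℕ.+ c ℕ.* f →
    suc n ℕ.* f ℕ.≤ suc n ℕ.* (suc i ℕ.* s) ℕ.+ c ℕ.* f →
    ∣ fromℕ s - + f / suc i ∣ ≤ η * (+ f / suc i)
  relative-error {s} {f} {c} {η} i n c≤nη upper lower = subst (λ z → ∣ S - z ∣ ≤ η * z) (sym (/≡fromℕ*unit f i))
    (*-cancelˡ-≤-pos (N * M) {{positive (0<* (0<fromℕ n) (0<fromℕ i))}} (begin
      N * M * ∣ S - F * unit i ∣          ≡⟨ cong (_* ∣ S - F * unit i ∣) (sym (0≤p⇒∣p∣≡p (0≤* (0≤fromℕ (suc n)) (0≤fromℕ (suc i))))) ⟩
      ∣ N * M ∣ * ∣ S - F * unit i ∣      ≡⟨ sym (∣p*q∣≡∣p∣*∣q∣ (N * M) (S - F * unit i)) ⟩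
      ∣ N * M * (S - F * unit i) ∣        ≡⟨ cong ∣_∣ (trans
          (solve 5 (λ n m s f u → n :* m :* (s :- f :* u) := n :* (m :* s) :- n :* f :* (m :* u)) refl N M S F (unit i))
          (cong (λ z → N * (M * S) - z) (trans (cong (N * F *_) (fromℕ*unit i)) (*-identityʳ (N * F))))) ⟩
      ∣ N * (M * S) - N * F ∣             ≤⟨ ∣-∣-lub
          (p≤q+r⇒p-q≤r {N * (M * S)} {N * F} (subst₂ _≤_ castS (cast+ (suc n ℕ.* f) (fromℕ-* (suc n) f)) (fromℕ-mono upper)))
          (subst (_≤ C * F) (solve 2 (λ a b → b :- a := :- (a :- b)) refl (N * (M * S)) (N * F))
            (p≤q+r⇒p-q≤r {N * F} {N * (M * S)} (subst₂ _≤_ (fromℕ-* (suc n) f) (cast+ (suc n ℕ.* (suc i ℕ.* s)) castS) (fromℕ-mono lower)))) ⟩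
      C * F                               ≤⟨ *-monoʳ (0≤fromℕ f) c≤nη ⟩
      N * η * F                           ≡⟨ sym (trans
          (solve 5 (λ n m h f u → n :* m :* (h :* (f :* u)) := n :* h :* f :* (m :* u)) refl N M η F (unit i))
          (trans (cong (N * η * F *_) (fromℕ*unit i)) (*-identityʳ (N * η * F)))) ⟩
      N * M * (η * (F * unit i))          ∎))
    where
    open ≤-Reasoning
    N M S F C : ℚ
    N = fromℕ (suc n)
    M = fromℕ (suc i)
    S = fromℕ s
    F = fromℕ f
    C = fromℕ c
    castS : fromℕ (suc n ℕ.* (suc i ℕ.* s)) ≡ N * (M * S)
    castS = trans (fromℕ-* (suc n) (suc i ℕ.* s)) (cong (N *_) (fromℕ-* (suc i) s))
    cast+ : ∀ x {z} → fromℕ x ≡ z → fromℕ (x ℕ.+ c ℕ.* f) ≡ z + C * F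
    cast+ x eq = trans (fromℕ-+ x (c ℕ.* f)) (cong₂ _+_ eq (fromℕ-* c f))

  -- An error bound of relative size c / n yields the asymptotic equivalence with
  -- 2 ^ e n / (i + 1), written as an exponential.
  exponential-asymptotics : ∀ i (f e : ℕ → ℕ) c →
    (∀ n → n ℕ.* (suc i ℕ.* f n) ℕ.≤ n ℕ.* 2 ℕ.^ e n ℕ.+ c ℕ.* 2 ℕ.^ e n ×
           n ℕ.* 2 ℕ.^ e n ℕ.≤ n ℕ.* (suc i ℕ.* f n) ℕ.+ c ℕ.* 2 ℕ.^ e n) →
    (λ n → fromℚ (fromℕ (f n))) ∼ (λ n → fromℚ (unit i) *ᴿ exp (fromℚ (fromℕ (e n)) *ᴿ log2))
  -- The successor makes n positive, so that the bound can be divided by n.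
  exponential-asymptotics i f e c bound ε 0<ε = suc (proj₁ large) , close
    where
    0<½ : 0ℚ < ½
    0<½ = positive⁻¹ ½
    η : ℚ
    η = ½ * (½ * ½ * ε)
    large : ∃[ N ] (∀ n → N ℕ.≤ n → fromℕ c ≤ fromℕ n * η)
    large = eventually-large {fromℕ c} (0<* 0<½ (0<* (0<* 0<½ 0<½) 0<ε))
    0<q : ∀ n → 0ℚ < + (2 ℕ.^ e n) / suc i
    0<q n = positive⁻¹ (+ (2 ℕ.^ e n) / suc i) {{normalize-pos (2 ℕ.^ e n) (suc i) {{_}} {{ℕ.m^n≢0 2 (e n)}}}}
    close : ∀ n → suc (proj₁ large) ℕ.≤ n → Σ _ λ gn#0 →
      ∣ divᴿ (fromℚ (fromℕ (f n))) (fromℚ (unit i) *ᴿ exp (fromℚ (fromℕ (e n)) *ᴿ log2)) gn#0 -ᴿ 1ᴿ ∣ᴿ <ᴿ fromℚ ε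
    close n@(suc n′) N<n = div-close {fromℕ (f n)} {+ (2 ℕ.^ e n) / suc i} {ε} (fromℚ (unit i) *ᴿ exp (fromℚ (fromℕ (e n)) *ᴿ log2)) (0<q n) 0<ε
      (scaled-exp-log2 i (e n))
      (relative-error {f n} {2 ℕ.^ e n} {c} {η} i n′ (proj₂ large n (ℕ.<⇒≤ N<n)) (proj₁ (bound n)) (proj₂ (bound n)))

open import Data.Integer.Base using (+_)
open import Data.List.Base using (map; sum; upTo)
open import Data.Nat.Base using (ℕ; suc; _*_; _^_; NonZero; ≢-nonZero⁻¹)
open import Data.Nat.Combinatorics using (_C_)
open import Data.Rational.Base using (_/_)
open BinomialSum using (binomialSum; binomialSum-close)
open Logarithm using (log2; exp-log2; scaled-exp-log2; exponential-asymptotics)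

theorem8p1 :
  Σ ℝ λ log2 → IsLog (fromℚ (fromℕ 2)) log2 ×
    ((m : ℕ) .{{_ : NonZero m}} →
      ((λ n → fromℚ (fromℕ (sum (map (λ k → (m * n) C (m * k)) (upTo (suc n))))))
        ∼ (λ n → fromℚ (+ 1 / m) *ᴿ exp (fromℚ (fromℕ (m * n)) *ᴿ log2)))
      × ((n : ℕ) → (fromℚ (+ 1 / m) *ᴿ exp (fromℚ (fromℕ (m * n)) *ᴿ log2))
          ≃ᴿ fromℚ (+ (2 ^ (m * n)) / m)))
theorem8p1 = log2 , exp-log2 , λ
  { 0         → contradiction refl (≢-nonZero⁻¹ 0)
  ; m@(suc i) → exponential-asymptotics i (binomialSum m) (m *_) (2 ^ m) (λ n → binomialSum-close m n)
              , λ n → scaled-exp-log2 i (m * n)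
  }
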